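{- Let $k_1,k_2,k_3\in\mathbb{Z}_{\ge0}$ and let $(X,Y,Z)$ be a $(k_1,k_2,k_3)$-CMM triple associated with the non-labeled cluster $(a,b,c)$, and assume $|b|>\max\{|a|,|c|\}$. Then there exist a unique $f\in\mathbb{Z}[x_1^{\pm1},x_2^{\pm1},x_3^{\pm1}]$, a unique $\sigma\in\mathfrak{S}_3$ and a unique vertex $v$ of $\mathrm{CMM}\mathbb{T}(k_1,k_2,k_3,\sigma,f)$ such that $v=(X,Y,Z)$.
   Context: Fix $k_1,k_2,k_3\in\mathbb{Z}_{\ge0}$, indeterminates $x_1,x_2,x_3$; $\mathbb{Z}[x^\pm]=\mathbb{Z}[x_1^{\pm1},x_2^{\pm1},x_3^{\pm1}]$. Mutations: $\mu_1(a,b,c)=(\frac{b^2+k_1bc+c^2}{a},b,c)$, $\mu_2(a,b,c)=(a,\frac{a^2+k_2ac+c^2}{b},c)$, $\mu_3(a,b,c)=(a,b,\frac{a^2+k_3ab+b^2}{c})$. Labeled clusters of $\mathcal{A}(k_1,k_2,k_3)$: triples obtained from $(x_1,x_2,x_3)$ by finitely many mutations; non-labeled clusters: permutations of labeled clusters; cluster variables: entries of labeled clusters. A cluster variable $y$ occurs in a unique position $i$ among labeled clusters; its parity is $k_y:=k_i$. $|a|$ denotes the value of a Laurent polynomial $a$ at $x_1=x_2=x_3=1$. $\mathscr{M}=\frac{x_1^2+x_2^2+x_3^2+k_1x_2x_3+k_2x_1x_3+k_3x_1x_2}{x_1x_2x_3}$, $T=\begin{bmatrix}-1&0\\ \mathscr{M}&-1\end{bmatrix}$.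 A CMM matrix is $X\in SL(2,\mathbb{Z}[x^\pm])$ with $(1,2)$-entry $x_{12}$ a cluster variable and $\mathrm{tr}X=-k_{x_{12}}$; a CMM triple is a triple $(X,Y,Z)$ of CMM matrices with $XYZ=T$ and $(x_{12},y_{12},z_{12})$ a non-labeled cluster (the triple is associated with it). For $\sigma\in\mathfrak{S}_3$, $f\in\mathbb{Z}[x^\pm]$, write $y_i=x_{\sigma(i)}$, $\kappa_i=k_{\sigma(i)}$ and define (with $(2,1)$-entries $*$ determined by determinant $1$): $X_\sigma(f)=\begin{bmatrix}f&y_1\\ *&-f-\kappa_1\end{bmatrix}$, $Y_\sigma(f)=\begin{bmatrix}\frac{fy_2-\kappa_2y_1-y_3}{y_1}&y_2\\ *&\frac{ -fy_2+y_3}{y_1}\end{bmatrix}$, $Z_\sigma(f)=\begin{bmatrix}\frac{fy_2y_3-\kappa_3y_1y_2-\kappa_2y_1y_3-y_1^2-y_3^2}{y_1y_2}&y_3\\ *&\frac{ -fy_2y_3+\kappa_2y_1y_3+y_1^2+y_3^2}{y_1y_2}\end{bmatrix}$. The tree $\mathrm{CMM}\mathbb{T}(k_1,k_2,k_3,\sigma,f)$ is the rooted planar binary tree whose root is $(X_\tau(f),\,Y_\tau(f)Z_\tau(f)Y_\tau(f)^{ -1},\,Y_\tau(f))$ with $\tau=\sigma\circ(2\ 3)$ (composition right to left), and in which each vertex $(X,Y,Z)$ has left child $(X,YZY^{ -1},Y)$ and right child $(Y,Y^{ -1}XY,Z)$. -}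

module Defs where

open import Data.Nat using (ℕ)
open import Data.Integer as ℤ using (ℤ; +_; -[1+_])
import Data.Integer.Properties as ℤP
open import Data.Fin using (Fin; zero; suc)
open import Data.List using (List; []; _∷_; _++_; map; concatMap)
open import Data.Product using (Σ; _×_; _,_; proj₁; proj₂)
open import Data.Product.Properties using (≡-dec)
open import Data.Sum using (_⊎_)
open import Relation.Nullary using (yes; no)
open import Relation.Binary.PropositionalEquality using (_≡_)
open import Data.Fin.Permutation using (Permutation′; _⟨$⟩ʳ_)

-- Laurent polynomials ℤ[x₁^±1, x₂^±1, x₃^±1]
-- An element is a finite formal sum of terms c·x^e (e ∈ ℤ³);
-- two elements are equal (≈) iff they have the same coefficient
-- at every exponent.

Exp : Set
Exp = ℤ × ℤ × ℤ

_≟E_ : (e e' : Exp) → Relation.Nullary.Dec (e ≡ e')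
_≟E_ = ≡-dec ℤ._≟_ (≡-dec ℤ._≟_ ℤ._≟_)

Term : Set
Term = ℤ × Exp

L : Set
L = List Term

coeff : L → Exp → ℤ
coeff [] e = + 0
coeff ((c , e') ∷ t) e with e' ≟E e
... | yes _ = c ℤ.+ coeff t e
... | no  _ = coeff t e

infix 4 _≈_
_≈_ : L → L → Set
p ≈ q = ∀ e → coeff p e ≡ coeff q e

addE : Exp → Exp → Exp
addE (a , b , c) (a' , b' , c') = (a ℤ.+ a' , b ℤ.+ b' , c ℤ.+ c')

infixl 6 _+L_ _-L_
infixl 7 _*L_

_+L_ : L → L → L
p +L q = p ++ q

-L_ : L → L
-L p = map (λ t → (ℤ.- proj₁ t , proj₂ t)) p

_-L_ : L → L → L
p -L q = p +L (-L q)

_*L_ : L → L → L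
p *L q = concatMap (λ t → map (λ s → (proj₁ t ℤ.* proj₁ s , addE (proj₂ t) (proj₂ s))) q) p

cst : ℤ → L
cst n = (n , + 0 , + 0 , + 0) ∷ []

cN : ℕ → L
cN n = cst (+ n)

0L 1L : L
0L = []
1L = cN 1

x₁ x₂ x₃ : L
x₁ = (+ 1 , + 1 , + 0 , + 0) ∷ []
x₂ = (+ 1 , + 0 , + 1 , + 0) ∷ []
x₃ = (+ 1 , + 0 , + 0 , + 1) ∷ []

x₁x₂x₃⁻¹ : L
x₁x₂x₃⁻¹ = (+ 1 , -[1+ 0 ] , -[1+ 0 ] , -[1+ 0 ]) ∷ []

var : Fin 3 → L
var zero = x₁
var (suc zero) = x₂
var (suc (suc zero)) = x₃

-- |a| : value at x₁ = x₂ = x₃ = 1 (sum of the coefficients)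
∣_∣L : L → ℤ
∣ [] ∣L = + 0
∣ t ∷ p ∣L = proj₁ t ℤ.+ ∣ p ∣L

kv : ℕ → ℕ → ℕ → Fin 3 → ℕ
kv k₁ k₂ k₃ zero = k₁
kv k₁ k₂ k₃ (suc zero) = k₂
kv k₁ k₂ k₃ (suc (suc zero)) = k₃

-- Labeled clusters of A(k₁,k₂,k₃).  A mutation a ↦ a' is recorded by
-- the exchange relation a'·a = (…), which determines a' uniquely
-- since ℤ[x^±] is an integral domain.

data LCluster (k₁ k₂ k₃ : ℕ) : L → L → L → Set where
  seed : LCluster k₁ k₂ k₃ x₁ x₂ x₃
  μ₁   : ∀ {a b c} a' → LCluster k₁ k₂ k₃ a b c →
         a' *L a ≈ b *L b +L cN k₁ *L b *L c +L c *L c →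
         LCluster k₁ k₂ k₃ a' b c
  μ₂   : ∀ {a b c} b' → LCluster k₁ k₂ k₃ a b c →
         b' *L b ≈ a *L a +L cN k₂ *L a *L c +L c *L c →
         LCluster k₁ k₂ k₃ a b' c
  μ₃   : ∀ {a b c} c' → LCluster k₁ k₂ k₃ a b c →
         c' *L c ≈ a *L a +L cN k₃ *L a *L b +L b *L b →
         LCluster k₁ k₂ k₃ a b c'

triple : L → L → L → Fin 3 → L
triple a b c zero = a
triple a b c (suc zero) = b
triple a b c (suc (suc zero)) = c

OccursAt : ℕ → ℕ → ℕ → Fin 3 → L → Set
OccursAt k₁ k₂ k₃ i y =
  Σ L λ a → Σ L λ b → Σ L λ c →
    LCluster k₁ k₂ k₃ a b c × y ≈ triple a b c i

NonLabeledCluster : ℕ → ℕ → ℕ → L → L → L → Set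
NonLabeledCluster k₁ k₂ k₃ a b c =
  Σ (Permutation′ 3) λ π → Σ L λ u → Σ L λ v → Σ L λ w →
    LCluster k₁ k₂ k₃ u v w ×
    (a ≈ triple u v w (π ⟨$⟩ʳ zero)) ×
    (b ≈ triple u v w (π ⟨$⟩ʳ suc zero)) ×
    (c ≈ triple u v w (π ⟨$⟩ʳ suc (suc zero)))

record M2 : Set where
  constructor mat
  field
    m11 m12 m21 m22 : L
open M2 public

infix 4 _≈M_
_≈M_ : M2 → M2 → Set
A ≈M B = (m11 A ≈ m11 B) × (m12 A ≈ m12 B) × (m21 A ≈ m21 B) × (m22 A ≈ m22 B)

infixl 7 _·_
_·_ : M2 → M2 → M2
A · B = mat (m11 A *L m11 B +L m12 A *L m21 B) (m11 A *L m12 B +L m12 A *L m22 B)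
            (m21 A *L m11 B +L m22 A *L m21 B) (m21 A *L m12 B +L m22 A *L m22 B)

det : M2 → L
det A = m11 A *L m22 A -L m12 A *L m21 A

tr : M2 → L
tr A = m11 A +L m22 A

-- inverse of a matrix of determinant 1 (the adjugate)
inv : M2 → M2
inv A = mat (m22 A) (-L m12 A) (-L m21 A) (m11 A)

𝓜 : ℕ → ℕ → ℕ → L
𝓜 k₁ k₂ k₃ = (x₁ *L x₁ +L x₂ *L x₂ +L x₃ *L x₃ +L cN k₁ *L x₂ *L x₃
             +L cN k₂ *L x₁ *L x₃ +L cN k₃ *L x₁ *L x₂) *L x₁x₂x₃⁻¹

T : ℕ → ℕ → ℕ → M2
T k₁ k₂ k₃ = mat (-L 1L) 0L (𝓜 k₁ k₂ k₃) (-L 1L)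

CMMMatrix : ℕ → ℕ → ℕ → M2 → Set
CMMMatrix k₁ k₂ k₃ X =
  (det X ≈ 1L) ×
  Σ (Fin 3) λ i → OccursAt k₁ k₂ k₃ i (m12 X) × (tr X ≈ -L cN (kv k₁ k₂ k₃ i))

record Triple : Set where
  constructor ⟨_,_,_⟩
  field
    t1 t2 t3 : M2
open Triple public

infix 4 _≈T_
_≈T_ : Triple → Triple → Set
u ≈T v = (t1 u ≈M t1 v) × (t2 u ≈M t2 v) × (t3 u ≈M t3 v)

CMMTriple : ℕ → ℕ → ℕ → Triple → Set
CMMTriple k₁ k₂ k₃ ⟨ X , Y , Z ⟩ =
  CMMMatrix k₁ k₂ k₃ X × CMMMatrix k₁ k₂ k₃ Y × CMMMatrix k₁ k₂ k₃ Z ×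
  (X · Y · Z ≈M T k₁ k₂ k₃) ×
  NonLabeledCluster k₁ k₂ k₃ (m12 X) (m12 Y) (m12 Z)

-- The matrices X_σ(f), Y_σ(f), Z_σ(f).  Entries that are quotients are
-- specified by the defining relation (numerator = entry · denominator);
-- the (2,1)-entry is specified by det = 1.

module _ (k₁ k₂ k₃ : ℕ) (σ : Fin 3 → Fin 3) (f : L) where
  y : Fin 3 → L
  y i = var (σ i)
  κ : Fin 3 → L
  κ i = cN (kv k₁ k₂ k₃ (σ i))

  private
    y1 y2 y3 κ1 κ2 κ3 : L
    y1 = y zero
    y2 = y (suc zero)
    y3 = y (suc (suc zero))
    κ1 = κ zero
    κ2 = κ (suc zero)
    κ3 = κ (suc (suc zero))

  IsXσ : M2 → Set
  IsXσ M = (m11 M ≈ f) × (m12 M ≈ y1) × (m22 M ≈ -L f -L κ1) × (det M ≈ 1L)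

  IsYσ : M2 → Set
  IsYσ M = (m11 M *L y1 ≈ f *L y2 -L κ2 *L y1 -L y3) × (m12 M ≈ y2)
         × (m22 M *L y1 ≈ -L f *L y2 +L y3) × (det M ≈ 1L)

  IsZσ : M2 → Set
  IsZσ M = (m11 M *L (y1 *L y2) ≈
              f *L y2 *L y3 -L κ3 *L y1 *L y2 -L κ2 *L y1 *L y3 -L y1 *L y1 -L y3 *L y3)
         × (m12 M ≈ y3)
         × (m22 M *L (y1 *L y2) ≈
              -L f *L y2 *L y3 +L κ2 *L y1 *L y3 +L y1 *L y1 +L y3 *L y3)
         × (det M ≈ 1L)

-- The tree CMM𝕋(k₁,k₂,k₃,σ,f).  A vertex is a path from the root
-- (list of left/right moves, read from the root).

data Dir : Set where
  left right : Dir

step : Dir → Triple → Triple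
step left  ⟨ X , Y , Z ⟩ = ⟨ X , Y · Z · inv Y , Y ⟩
step right ⟨ X , Y , Z ⟩ = ⟨ Y , inv Y · X · Y , Z ⟩

walk : List Dir → Triple → Triple
walk [] t = t
walk (d ∷ p) t = walk p (step d t)

swap23 : Fin 3 → Fin 3
swap23 zero = zero
swap23 (suc zero) = suc (suc zero)
swap23 (suc (suc zero)) = suc zero

τ : Permutation′ 3 → Fin 3 → Fin 3
τ σ i = σ ⟨$⟩ʳ (swap23 i)

IsVertex : ℕ → ℕ → ℕ → Permutation′ 3 → L → List Dir → Triple → Set
IsVertex k₁ k₂ k₃ σ f p v =
  Σ M2 λ Xm → Σ M2 λ Ym → Σ M2 λ Zm →
    IsXσ k₁ k₂ k₃ (τ σ) f Xm × IsYσ k₁ k₂ k₃ (τ σ) f Ym ×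
    IsZσ k₁ k₂ k₃ (τ σ) f Zm ×
    (walk p ⟨ Xm , Ym · Zm · inv Ym , Ym ⟩ ≈T v)

{-# OPTIONS --safe #-}

-- If XYZ = T with all determinants 1, then (XY)₁₂ = z₁₂ and (YZ)₁₂ = x₁₂, and conjugating one of the
-- matrices by a neighbour mutates its (1,2)-entry.  So the edges of the tree lift cluster mutations, and both
-- kinds of edges can be inverted by conjugating back.
--
-- Existence.  Every cluster is reached by a reduced mutation sequence, along which the last mutated entry is
-- the strict maximum of the values |·|.  Undoing the last mutation of the cluster of (X,Y,Z) therefore
-- corresponds to an inverse tree step, and after finitely many of them the cluster is the seed; there the
-- relations above force the matrices to be X_τ(f), Y_τ(f), Z_τ(f) with f = x₁₁.  The traces of X, Y, Z are the
-- right ones because a cluster variable occurs in only one position: the leading exponent of a variable in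
-- position i is the i-th unit vector modulo 2, since in a'a = b² + kbc + c² the right-hand side has a leading
-- exponent that is twice a vector.
--
-- Uniqueness.  The values |·| grow along the tree, so the last step to a vertex is read off from whether |a| < |c|
-- or |c| < |a|, while |a| = |c| at the root; undoing steps recovers the path, the root, f and σ.
module Submission where

open import Defs hiding (_≈_)
open import Data.Nat as ℕ using (ℕ; zero; suc; z≤n)
open import Data.Nat.Properties using (+-suc)
open import Data.Integer using (_<_; _⊔_)
open import Data.Integer as ℤ using (ℤ; +_; +<+; +≤+)
import Data.Integer.Properties as ℤP
open import Data.Integer.Solver using (module +-*-Solver)
open import Data.Fin using (Fin; zero; suc)
open import Data.Fin.Properties using (_≟_; all?)
open import Data.Fin.Permutation using (Permutation′; _⟨$⟩ʳ_; _⟨$⟩ˡ_; _∘ₚ_; transpose; inverseˡ)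
open import Data.List using (List; []; _∷_; _++_; _∷ʳ_; map; reverse)
open import Data.List.Properties using (unfold-reverse; reverse-involutive)
open import Data.List.Relation.Unary.All as All using (All; []; _∷_)
import Data.List.Relation.Unary.All.Properties as AllP
open import Data.Maybe using (Maybe; just; nothing)
import Data.Maybe.Properties as MaybeP
open import Data.Product using (Σ; _×_; _,_; proj₁; proj₂)
open import Data.Sum using (_⊎_; inj₁; inj₂; [_,_]′)
open import Data.Empty using (⊥-elim)
open import Relation.Nullary using (¬_; yes; no)
open import Relation.Nullary.Decidable using (from-yes; _⊎-dec_)
open import Relation.Binary.Definitions using (WeaklyDecidable; tri<; tri≈; tri>)
open import Relation.Binary.PropositionalEquality using (_≡_; _≢_; refl; sym; trans; cong; cong₂; subst; subst₂; module ≡-Reasoning)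
open import Level using (0ℓ)
open import Algebra.Bundles using (CommutativeRing)
open import Algebra.Bundles.Raw using (RawRing)
open import Algebra.Solver.Ring.AlmostCommutativeRing using (_-Raw-AlmostCommutative⟶_; fromCommutativeRing; Induced-equivalence)
import Algebra.Solver.Ring as RingSolver

-- Laurent polynomials as a commutative ring

-- A formal sum is read as a finitely supported integer measure on ℤ³ and integrated against `φ`.
-- Integrating `δ g` gives `coeff`, integrating the constant 1 gives `∣_∣L`, and products become
-- convolutions.
pair : L → (Exp → ℤ) → ℤ
pair [] φ = + 0
pair ((c , e) ∷ p) φ = c ℤ.* φ e ℤ.+ pair p φ

-- Testing against every function of the exponent, not just against indicator functions, makes the ring laws
-- immediate; the relation agrees with Defs._≈_ because every polynomial has a sorted normal form.
infix 4 _≋_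
record _≋_ (p q : L) : Set where
  constructor pairs
  field pair-≡ : ∀ φ → pair p φ ≡ pair q φ

≋-refl : ∀ {p} → p ≋ p
≋-refl = pairs λ _ → refl

≋-sym : ∀ {p q} → p ≋ q → q ≋ p
≋-sym (pairs h) = pairs λ φ → sym (h φ)

≋-trans : ∀ {p q r} → p ≋ q → q ≋ r → p ≋ r
≋-trans (pairs h) (pairs h′) = pairs λ φ → trans (h φ) (h′ φ)

pair-cong : ∀ p {φ ψ} → (∀ e → φ e ≡ ψ e) → pair p φ ≡ pair p ψ
pair-cong [] h = refl
pair-cong ((c , e) ∷ p) h = cong₂ (λ a b → c ℤ.* a ℤ.+ b) (h e) (pair-cong p h)

pair-zero : ∀ p → pair p (λ _ → + 0) ≡ + 0
pair-zero [] = refl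
pair-zero ((c , e) ∷ p) = cong₂ ℤ._+_ (ℤP.*-zeroʳ c) (pair-zero p)

pair-+ : ∀ p φ ψ → pair p (λ e → φ e ℤ.+ ψ e) ≡ pair p φ ℤ.+ pair p ψ
pair-+ [] φ ψ = refl
pair-+ ((c , e) ∷ p) φ ψ rewrite pair-+ p φ ψ =
  solve 5 (λ c a b s t → c :* (a :+ b) :+ (s :+ t) := c :* a :+ s :+ (c :* b :+ t)) refl
    c (φ e) (ψ e) (pair p φ) (pair p ψ)
  where open +-*-Solver

pair-scale : ∀ p d φ → pair p (λ e → d ℤ.* φ e) ≡ d ℤ.* pair p φ
pair-scale [] d φ = sym (ℤP.*-zeroʳ d)
pair-scale ((c , e) ∷ p) d φ rewrite pair-scale p d φ =
  solve 4 (λ c d a s → c :* (d :* a) :+ d :* s := d :* (c :* a :+ s)) refl c d (φ e) (pair p φ)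
  where open +-*-Solver

pair-++ : ∀ p q φ → pair (p ++ q) φ ≡ pair p φ ℤ.+ pair q φ
pair-++ [] q φ = sym (ℤP.+-identityˡ _)
pair-++ ((c , e) ∷ p) q φ =
  trans (cong (λ s → c ℤ.* φ e ℤ.+ s) (pair-++ p q φ)) (sym (ℤP.+-assoc (c ℤ.* φ e) _ _))

pair-neg : ∀ p φ → pair (-L p) φ ≡ ℤ.- pair p φ
pair-neg [] φ = refl
pair-neg ((c , e) ∷ p) φ rewrite pair-neg p φ =
  solve 3 (λ c a s → (:- c) :* a :+ (:- s) := :- (c :* a :+ s)) refl c (φ e) (pair p φ)
  where open +-*-Solver

pair-shift : ∀ c e q φ →
  pair (map (λ s → (c ℤ.* proj₁ s , addE e (proj₂ s))) q) φ ≡ c ℤ.* pair q (λ g → φ (addE e g))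
pair-shift c e [] φ = sym (ℤP.*-zeroʳ c)
pair-shift c e ((d , g) ∷ q) φ rewrite pair-shift c e q φ =
  solve 4 (λ c d a s → c :* d :* a :+ c :* s := c :* (d :* a :+ s)) refl
    c d (φ (addE e g)) (pair q (λ g → φ (addE e g)))
  where open +-*-Solver

pair-* : ∀ p q φ → pair (p *L q) φ ≡ pair p (λ e → pair q (λ g → φ (addE e g)))
pair-* [] q φ = refl
pair-* ((c , e) ∷ p) q φ =
  trans (pair-++ (map (λ s → (c ℤ.* proj₁ s , addE e (proj₂ s))) q) (p *L q) φ)
        (cong₂ ℤ._+_ (pair-shift c e q φ) (pair-* p q φ))

-- Fubini for finite sums; together with `pair-*` it reduces commutativity of `*L` to that of
-- `addE`.
pair-swap : ∀ p q (ψ : Exp → Exp → ℤ) →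
  pair p (λ e → pair q (ψ e)) ≡ pair q (λ g → pair p (λ e → ψ e g))
pair-swap [] q ψ = sym (pair-zero q)
pair-swap ((c , e) ∷ p) q ψ = sym (begin
  pair q (λ g → c ℤ.* ψ e g ℤ.+ pair p (λ e → ψ e g))
    ≡⟨ pair-+ q (λ g → c ℤ.* ψ e g) (λ g → pair p (λ e → ψ e g)) ⟩
  pair q (λ g → c ℤ.* ψ e g) ℤ.+ pair q (λ g → pair p (λ e → ψ e g))
    ≡⟨ cong₂ ℤ._+_ (pair-scale q c (ψ e)) (sym (pair-swap p q ψ)) ⟩
  c ℤ.* pair q (ψ e) ℤ.+ pair p (λ e → pair q (ψ e)) ∎)
  where open ≡-Reasoning

addE-comm : ∀ e g → addE e g ≡ addE g e
addE-comm (a , b , c) (a′ , b′ , c′) =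
  cong₂ _,_ (ℤP.+-comm a a′) (cong₂ _,_ (ℤP.+-comm b b′) (ℤP.+-comm c c′))

addE-assoc : ∀ e g h → addE (addE e g) h ≡ addE e (addE g h)
addE-assoc (a , b , c) (a′ , b′ , c′) (a″ , b″ , c″) =
  cong₂ _,_ (ℤP.+-assoc a a′ a″) (cong₂ _,_ (ℤP.+-assoc b b′ b″) (ℤP.+-assoc c c′ c″))

zeroE : Exp
zeroE = (+ 0 , + 0 , + 0)

addE-identityˡ : ∀ e → addE zeroE e ≡ e
addE-identityˡ (a , b , c) =
  cong₂ _,_ (ℤP.+-identityˡ a) (cong₂ _,_ (ℤP.+-identityˡ b) (ℤP.+-identityˡ c))

+L-cong : ∀ {p p′ q q′} → p ≋ p′ → q ≋ q′ → p +L q ≋ p′ +L q′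
+L-cong {p} {p′} {q} {q′} (pairs h) (pairs h′) = pairs λ φ →
  trans (pair-++ p q φ) (trans (cong₂ ℤ._+_ (h φ) (h′ φ)) (sym (pair-++ p′ q′ φ)))

-L-cong : ∀ {p p′} → p ≋ p′ → -L p ≋ -L p′
-L-cong {p} {p′} (pairs h) = pairs λ φ →
  trans (pair-neg p φ) (trans (cong ℤ.-_ (h φ)) (sym (pair-neg p′ φ)))

*L-cong : ∀ {p p′ q q′} → p ≋ p′ → q ≋ q′ → p *L q ≋ p′ *L q′
*L-cong {p} {p′} {q} {q′} (pairs h) (pairs h′) = pairs λ φ →
  trans (pair-* p q φ) (trans (h _)
    (trans (pair-cong p′ (λ e → h′ _)) (sym (pair-* p′ q′ φ))))

+L-assoc : ∀ p q r → (p +L q) +L r ≋ p +L (q +L r)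
+L-assoc p q r = pairs λ φ → begin
  pair ((p ++ q) ++ r) φ                       ≡⟨ pair-++ (p ++ q) r φ ⟩
  pair (p ++ q) φ ℤ.+ pair r φ                 ≡⟨ cong (ℤ._+ pair r φ) (pair-++ p q φ) ⟩
  pair p φ ℤ.+ pair q φ ℤ.+ pair r φ           ≡⟨ ℤP.+-assoc (pair p φ) _ _ ⟩
  pair p φ ℤ.+ (pair q φ ℤ.+ pair r φ)         ≡⟨ cong (λ s → pair p φ ℤ.+ s) (sym (pair-++ q r φ)) ⟩
  pair p φ ℤ.+ pair (q ++ r) φ                 ≡⟨ sym (pair-++ p (q ++ r) φ) ⟩
  pair (p ++ (q ++ r)) φ                       ∎
  where open ≡-Reasoning

+L-comm : ∀ p q → p +L q ≋ q +L p
+L-comm p q = pairs λ φ →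
  trans (pair-++ p q φ) (trans (ℤP.+-comm (pair p φ) _) (sym (pair-++ q p φ)))

+L-identityʳ : ∀ p → p +L 0L ≋ p
+L-identityʳ p = pairs λ φ → trans (pair-++ p [] φ) (ℤP.+-identityʳ _)

-L-inverseʳ : ∀ p → p +L (-L p) ≋ 0L
-L-inverseʳ p = pairs λ φ →
  trans (pair-++ p (-L p) φ) (trans (cong (λ s → pair p φ ℤ.+ s) (pair-neg p φ)) (ℤP.+-inverseʳ (pair p φ)))

*L-assoc : ∀ p q r → (p *L q) *L r ≋ p *L (q *L r)
*L-assoc p q r = pairs λ φ → begin
  pair ((p *L q) *L r) φ
    ≡⟨ pair-* (p *L q) r φ ⟩
  pair (p *L q) (λ e → pair r (λ g → φ (addE e g)))
    ≡⟨ pair-* p q _ ⟩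
  pair p (λ e → pair q (λ g → pair r (λ h → φ (addE (addE e g) h))))
    ≡⟨ pair-cong p (λ e → trans
         (pair-cong q (λ g → pair-cong r (λ h → cong φ (addE-assoc e g h))))
         (sym (pair-* q r (λ h → φ (addE e h))))) ⟩
  pair p (λ e → pair (q *L r) (λ h → φ (addE e h)))
    ≡⟨ sym (pair-* p (q *L r) φ) ⟩
  pair (p *L (q *L r)) φ ∎
  where open ≡-Reasoning

*L-comm : ∀ p q → p *L q ≋ q *L p
*L-comm p q = pairs λ φ → begin
  pair (p *L q) φ                                 ≡⟨ pair-* p q φ ⟩
  pair p (λ e → pair q (λ g → φ (addE e g)))      ≡⟨ pair-swap p q (λ e g → φ (addE e g)) ⟩
  pair q (λ g → pair p (λ e → φ (addE e g)))
    ≡⟨ pair-cong q (λ g → pair-cong p (λ e → cong φ (addE-comm e g))) ⟩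
  pair q (λ g → pair p (λ e → φ (addE g e)))      ≡⟨ sym (pair-* q p φ) ⟩
  pair (q *L p) φ                                 ∎
  where open ≡-Reasoning

*L-identityˡ : ∀ p → 1L *L p ≋ p
*L-identityˡ p = pairs λ φ →
  trans (pair-* 1L p φ) (trans (ℤP.+-identityʳ _) (trans (ℤP.*-identityˡ _)
    (pair-cong p (λ e → cong φ (addE-identityˡ e)))))

*L-distribˡ : ∀ p q r → p *L (q +L r) ≋ p *L q +L p *L r
*L-distribˡ p q r = pairs λ φ → begin
  pair (p *L (q ++ r)) φ                                       ≡⟨ pair-* p (q ++ r) φ ⟩
  pair p (λ e → pair (q ++ r) (λ g → φ (addE e g)))            ≡⟨ pair-cong p (λ e → pair-++ q r _) ⟩
  pair p (λ e → pair q (λ g → φ (addE e g)) ℤ.+ pair r (λ g → φ (addE e g)))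
    ≡⟨ pair-+ p _ _ ⟩
  pair p (λ e → pair q (λ g → φ (addE e g))) ℤ.+ pair p (λ e → pair r (λ g → φ (addE e g)))
    ≡⟨ sym (cong₂ ℤ._+_ (pair-* p q φ) (pair-* p r φ)) ⟩
  pair (p *L q) φ ℤ.+ pair (p *L r) φ                          ≡⟨ sym (pair-++ (p *L q) (p *L r) φ) ⟩
  pair (p *L q ++ p *L r) φ                                    ∎
  where open ≡-Reasoning

L-commutativeRing : CommutativeRing 0ℓ 0ℓ
L-commutativeRing = record
  { Carrier = L ; _≈_ = _≋_ ; _+_ = _+L_ ; _*_ = _*L_ ; -_ = -L_ ; 0# = 0L ; 1# = 1L
  ; isCommutativeRing = record
    { isRing = record
      { +-isAbelianGroup = record
        { isGroup = record
          { isMonoid = record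
            { isSemigroup = record
              { isMagma = record
                { isEquivalence = record { refl = ≋-refl ; sym = ≋-sym ; trans = ≋-trans }
                ; ∙-cong = +L-cong }
              ; assoc = +L-assoc }
            ; identity = (λ p → ≋-refl) , +L-identityʳ }
          ; inverse = (λ p → ≋-trans (+L-comm (-L p) p) (-L-inverseʳ p)) , -L-inverseʳ
          ; ⁻¹-cong = -L-cong }
        ; comm = +L-comm }
      ; *-cong = *L-cong
      ; *-assoc = *L-assoc
      ; *-identity = *L-identityˡ , λ p → ≋-trans (*L-comm p 1L) (*L-identityˡ p)
      ; distrib = *L-distribˡ , λ p q r →
          ≋-trans (*L-comm (q +L r) p)
            (≋-trans (*L-distribˡ p q r) (+L-cong (*L-comm p q) (*L-comm p r))) }
    ; *-comm = *L-comm } }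

cst-+ : ∀ a b → cst (a ℤ.+ b) ≋ cst a +L cst b
cst-+ a b = pairs λ φ →
  solve 3 (λ a b s → (a :+ b) :* s :+ con (+ 0) := a :* s :+ (b :* s :+ con (+ 0))) refl a b (φ zeroE)
  where open +-*-Solver

cst-* : ∀ a b → cst (a ℤ.* b) ≋ cst a *L cst b
cst-* a b = ≋-refl

cst-neg : ∀ a → cst (ℤ.- a) ≋ -L cst a
cst-neg a = ≋-refl

cst-0 : cst (+ 0) ≋ 0L
cst-0 = pairs λ φ → refl

-- Evaluation at x₁ = x₂ = x₃ = 1

value-pair : ∀ p → ∣ p ∣L ≡ pair p (λ _ → + 1)
value-pair [] = refl
value-pair ((c , e) ∷ p) = cong₂ ℤ._+_ (sym (ℤP.*-identityʳ c)) (value-pair p)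

value-cong : ∀ {p q} → p ≋ q → ∣ p ∣L ≡ ∣ q ∣L
value-cong {p} {q} (pairs h) = trans (value-pair p) (trans (h _) (sym (value-pair q)))

value-+ : ∀ p q → ∣ p +L q ∣L ≡ ∣ p ∣L ℤ.+ ∣ q ∣L
value-+ p q = trans (value-pair (p +L q)) (trans (pair-++ p q _)
  (sym (cong₂ ℤ._+_ (value-pair p) (value-pair q))))

value-neg : ∀ p → ∣ -L p ∣L ≡ ℤ.- ∣ p ∣L
value-neg p = trans (value-pair (-L p)) (trans (pair-neg p _) (cong ℤ.-_ (sym (value-pair p))))

value-* : ∀ p q → ∣ p *L q ∣L ≡ ∣ p ∣L ℤ.* ∣ q ∣L
value-* p q = begin
  ∣ p *L q ∣L                                        ≡⟨ value-pair (p *L q) ⟩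
  pair (p *L q) (λ _ → + 1)                          ≡⟨ pair-* p q _ ⟩
  pair p (λ _ → pair q (λ _ → + 1))                  ≡⟨ pair-cong p (λ _ → sym (ℤP.*-identityʳ _)) ⟩
  pair p (λ _ → pair q (λ _ → + 1) ℤ.* + 1)          ≡⟨ pair-scale p (pair q (λ _ → + 1)) (λ _ → + 1) ⟩
  pair q (λ _ → + 1) ℤ.* pair p (λ _ → + 1)          ≡⟨ ℤP.*-comm (pair q _) _ ⟩
  pair p (λ _ → + 1) ℤ.* pair q (λ _ → + 1)          ≡⟨ sym (cong₂ ℤ._*_ (value-pair p) (value-pair q)) ⟩
  ∣ p ∣L ℤ.* ∣ q ∣L                                  ∎
  where open ≡-Reasoning

value-cst : ∀ n → ∣ cst n ∣L ≡ n
value-cst n = ℤP.+-identityʳ n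

-- Lexicographic order on exponents

infix 4 _<E_
_<E_ : Exp → Exp → Set
(a , b , c) <E (a′ , b′ , c′) =
  a ℤ.< a′ ⊎ (a ≡ a′ × (b ℤ.< b′ ⊎ (b ≡ b′ × c ℤ.< c′)))

<E-irrefl : ∀ {e} → ¬ e <E e
<E-irrefl (inj₁ h) = ℤP.<-irrefl refl h
<E-irrefl (inj₂ (_ , inj₁ h)) = ℤP.<-irrefl refl h
<E-irrefl (inj₂ (_ , inj₂ (_ , h))) = ℤP.<-irrefl refl h

<E-trans : ∀ {e g h} → e <E g → g <E h → e <E h
<E-trans (inj₁ p) (inj₁ q) = inj₁ (ℤP.<-trans p q)
<E-trans (inj₁ p) (inj₂ (refl , _)) = inj₁ p
<E-trans (inj₂ (refl , _)) (inj₁ q) = inj₁ q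
<E-trans (inj₂ (refl , inj₁ p)) (inj₂ (refl , inj₁ q)) = inj₂ (refl , inj₁ (ℤP.<-trans p q))
<E-trans (inj₂ (refl , inj₁ p)) (inj₂ (refl , inj₂ (refl , _))) = inj₂ (refl , inj₁ p)
<E-trans (inj₂ (refl , inj₂ (refl , _))) (inj₂ (refl , inj₁ q)) = inj₂ (refl , inj₁ q)
<E-trans (inj₂ (refl , inj₂ (refl , p))) (inj₂ (refl , inj₂ (refl , q))) =
  inj₂ (refl , inj₂ (refl , ℤP.<-trans p q))

<E-cmp : ∀ e g → e <E g ⊎ e ≡ g ⊎ g <E e
<E-cmp (a , b , c) (a′ , b′ , c′) with ℤP.<-cmp a a′
... | tri< h _ _ = inj₁ (inj₁ h)
... | tri> _ _ h = inj₂ (inj₂ (inj₁ h))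
... | tri≈ _ refl _ with ℤP.<-cmp b b′
...   | tri< h _ _ = inj₁ (inj₂ (refl , inj₁ h))
...   | tri> _ _ h = inj₂ (inj₂ (inj₂ (refl , inj₁ h)))
...   | tri≈ _ refl _ with ℤP.<-cmp c c′
...     | tri< h _ _ = inj₁ (inj₂ (refl , inj₂ (refl , h)))
...     | tri> _ _ h = inj₂ (inj₂ (inj₂ (refl , inj₂ (refl , h))))
...     | tri≈ _ refl _ = inj₂ (inj₁ refl)

addE-monoʳ : ∀ h {e g} → e <E g → addE h e <E addE h g
addE-monoʳ (a , _ , _) (inj₁ p) = inj₁ (ℤP.+-monoʳ-< a p)
addE-monoʳ (_ , b , _) (inj₂ (refl , inj₁ p)) = inj₂ (refl , inj₁ (ℤP.+-monoʳ-< b p))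
addE-monoʳ (_ , _ , c) (inj₂ (refl , inj₂ (refl , p))) = inj₂ (refl , inj₂ (refl , ℤP.+-monoʳ-< c p))

Below : Exp → L → Set
Below e = All (λ t → proj₂ t <E e)

below-mono : ∀ {e g p} → e <E g → Below e p → Below g p
below-mono h = All.map (λ k → <E-trans k h)

coeff-below : ∀ {e p} → Below e p → coeff p e ≡ + 0
coeff-below [] = refl
coeff-below {e} {(c , g) ∷ p} (h ∷ b) with g ≟E e
... | yes refl = ⊥-elim (<E-irrefl h)
... | no _ = coeff-below b

coeff-head : ∀ c e p → coeff ((c , e) ∷ p) e ≡ c ℤ.+ coeff p e
coeff-head c e p with e ≟E e
... | yes _ = refl
... | no h = ⊥-elim (h refl)

δ : Exp → Exp → ℤ
δ g e with e ≟E g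
... | yes _ = + 1
... | no _ = + 0

coeff-pair : ∀ p g → coeff p g ≡ pair p (δ g)
coeff-pair [] g = refl
coeff-pair ((c , e) ∷ p) g with e ≟E g
... | yes _ = cong₂ ℤ._+_ (sym (ℤP.*-identityʳ c)) (coeff-pair p g)
... | no _ = trans (coeff-pair p g)
  (sym (trans (cong (ℤ._+ pair p (δ g)) (ℤP.*-zeroʳ c)) (ℤP.+-identityˡ _)))

≋⇒≈ : ∀ {p q} → p ≋ q → p Defs.≈ q
≋⇒≈ {p} {q} (pairs h) e = trans (coeff-pair p e) (trans (h _) (sym (coeff-pair q e)))

-- Since coefficients are nonzero and exponents strictly decrease, the empty list is the only such
-- form of zero, and the head of any other form is its leading term.
data Descending : L → Set where
  [] : Descending []
  cons : ∀ {c e p} → c ≢ + 0 → Below e p → Descending p → Descending ((c , e) ∷ p)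

∷-cong : ∀ t {p q} → p ≋ q → t ∷ p ≋ t ∷ q
∷-cong t (pairs h) = pairs λ φ → cong (λ s → proj₁ t ℤ.* φ (proj₂ t) ℤ.+ s) (h φ)

∷-swap : ∀ t s p → t ∷ s ∷ p ≋ s ∷ t ∷ p
∷-swap (c , e) (d , g) p = pairs λ φ →
  solve 3 (λ x y z → x :+ (y :+ z) := y :+ (x :+ z)) refl (c ℤ.* φ e) (d ℤ.* φ g) (pair p φ)
  where open +-*-Solver

∷-merge : ∀ c d e p → (c , e) ∷ (d , e) ∷ p ≋ (c ℤ.+ d , e) ∷ p
∷-merge c d e p = pairs λ φ →
  solve 4 (λ c d x z → c :* x :+ (d :* x :+ z) := (c :+ d) :* x :+ z) refl c d (φ e) (pair p φ)
  where open +-*-Solver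

∷-drop : ∀ e p → (+ 0 , e) ∷ p ≋ p
∷-drop e p = pairs λ φ → ℤP.+-identityˡ _

-- Merging may cancel the head, so the head of the result cannot be predicted. The returned
-- preservation of upper bounds is what allows the recursive case to put `(c₀ , e₀)` back in front.
insert : ∀ c e p → Descending p →
  Σ L λ q → Descending q × (∀ {g} → e <E g → Below g p → Below g q) × (c , e) ∷ p ≋ q
insert c e p d with c ℤ.≟ + 0
... | yes refl = p , d , (λ _ b → b) , ∷-drop e p
insert c e [] [] | no c≢0 = (c , e) ∷ [] , cons c≢0 [] [] , (λ h b → h ∷ b) , ≋-refl
insert c e ((c₀ , e₀) ∷ p) d@(cons c₀≢0 b₀ d₀) | no c≢0 with <E-cmp e e₀
... | inj₂ (inj₂ h) =
  (c , e) ∷ (c₀ , e₀) ∷ p , cons c≢0 (h ∷ below-mono h b₀) d , (λ k b → k ∷ b) , ≋-refl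
... | inj₁ h with insert c e p d₀
...   | q , dq , bq , eq =
  (c₀ , e₀) ∷ q , cons c₀≢0 (bq h b₀) dq , (λ { k (k₀ ∷ b) → k₀ ∷ bq k b }) ,
  ≋-trans (∷-swap (c , e) (c₀ , e₀) p) (∷-cong (c₀ , e₀) eq)
insert c e ((c₀ , e₀) ∷ p) d@(cons c₀≢0 b₀ d₀) | no c≢0 | inj₂ (inj₁ refl) with c ℤ.+ c₀ ℤ.≟ + 0
... | yes z = p , d₀ , (λ { _ (_ ∷ b) → b }) ,
  ≋-trans (∷-merge c c₀ e p) (subst (λ s → (s , e) ∷ p ≋ p) (sym z) (∷-drop e p))
... | no nz = (c ℤ.+ c₀ , e) ∷ p , cons nz b₀ d₀ , (λ { k (_ ∷ b) → k ∷ b }) , ∷-merge c c₀ e p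

normalise : ∀ p → Σ L λ q → Descending q × p ≋ q
normalise [] = [] , [] , ≋-refl
normalise ((c , e) ∷ p) with normalise p
... | q , dq , eq with insert c e q dq
...   | r , dr , _ , eq′ = r , dr , ≋-trans (∷-cong (c , e) eq) eq′

-- The head coefficient of a nonempty normal form is the coefficient at its exponent, so only the
-- empty form has all coefficients zero.
≈0⇒≋0 : ∀ {p} → p Defs.≈ 0L → p ≋ 0L
≈0⇒≋0 {p} z with normalise p
... | [] , _ , eq = eq
... | (c , e) ∷ q , cons c≢0 b _ , eq = ⊥-elim (c≢0 (begin
  c                       ≡⟨ sym (ℤP.+-identityʳ c) ⟩
  c ℤ.+ + 0               ≡⟨ cong (λ s → c ℤ.+ s) (sym (coeff-below b)) ⟩
  c ℤ.+ coeff q e         ≡⟨ sym (coeff-head c e q) ⟩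
  coeff ((c , e) ∷ q) e   ≡⟨ sym (≋⇒≈ eq e) ⟩
  coeff p e               ≡⟨ z e ⟩
  + 0                     ∎))
  where open ≡-Reasoning

-≋0⇒≋ : ∀ p q → p -L q ≋ 0L → p ≋ q
-≋0⇒≋ p q (pairs h) = pairs λ φ → ℤP.i-j≡0⇒i≡j (pair p φ) (pair q φ)
  (trans (cong (λ s → pair p φ ℤ.+ s) (sym (pair-neg q φ))) (trans (sym (pair-++ p (-L q) φ)) (h φ)))

≈⇒≋ : ∀ {p q} → p Defs.≈ q → p ≋ q
≈⇒≋ {p} {q} h = -≋0⇒≋ p q (≈0⇒≋0 λ e → begin
  coeff (p -L q) e                            ≡⟨ coeff-pair (p -L q) e ⟩
  pair (p -L q) (δ e)                         ≡⟨ pair-++ p (-L q) (δ e) ⟩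
  pair p (δ e) ℤ.+ pair (-L q) (δ e)          ≡⟨ cong (λ s → pair p (δ e) ℤ.+ s) (pair-neg q (δ e)) ⟩
  pair p (δ e) ℤ.- pair q (δ e)               ≡⟨ cong₂ ℤ._-_ (sym (coeff-pair p e)) (sym (coeff-pair q e)) ⟩
  coeff p e ℤ.- coeff q e                     ≡⟨ ℤP.i≡j⇒i-j≡0 (h e) ⟩
  + 0                                         ∎)
  where open ≡-Reasoning

-- `Lead p e c`: no exponent of p exceeds e, and c (possibly 0) is the coefficient at e.
record Lead (p : L) (e : Exp) (c : ℤ) : Set where
  constructor lead
  field
    {rest} : L
    rest-below : Below e rest
    split : p ≋ (c , e) ∷ rest

lead-cong : ∀ {p q e c} → p ≋ q → Lead p e c → Lead q e c
lead-cong h (lead b s) = lead b (≋-trans (≋-sym h) s)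

lead-coeff : ∀ {p e c} → Lead p e c → coeff p e ≡ c
lead-coeff {p} {e} {c} (lead {r} b s) = begin
  coeff p e               ≡⟨ ≋⇒≈ s e ⟩
  coeff ((c , e) ∷ r) e   ≡⟨ coeff-head c e r ⟩
  c ℤ.+ coeff r e         ≡⟨ cong (λ x → c ℤ.+ x) (coeff-below b) ⟩
  c ℤ.+ + 0               ≡⟨ ℤP.+-identityʳ c ⟩
  c                       ∎
  where open ≡-Reasoning

-- Allowing the coefficient 0 brings two polynomials to a common exponent, as `lead-+` requires.
lead-raise : ∀ {p e c g} → e <E g → Lead p e c → Lead p g (+ 0)
lead-raise h (lead b s) = lead (h ∷ below-mono h b) (≋-trans s (≋-sym (∷-drop _ _)))

lead-unique : ∀ {p e c g d} → c ≢ + 0 → d ≢ + 0 → Lead p e c → Lead p g d → e ≡ g × c ≡ d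
lead-unique {p} {e} {c} {g} {d} c≢0 d≢0 l m with <E-cmp e g
... | inj₁ h = ⊥-elim (d≢0 (trans (sym (lead-coeff m)) (lead-coeff (lead-raise h l))))
... | inj₂ (inj₂ h) = ⊥-elim (c≢0 (trans (sym (lead-coeff l)) (lead-coeff (lead-raise h m))))
... | inj₂ (inj₁ refl) = refl , trans (sym (lead-coeff l)) (lead-coeff m)

lead-+ : ∀ {p q e c d} → Lead p e c → Lead q e d → Lead (p +L q) e (c ℤ.+ d)
lead-+ {p} {q} {e} {c} {d} (lead {r} b s) (lead {r′} b′ s′) =
  lead (AllP.++⁺ b b′) (≋-trans (+L-cong s s′) (pairs λ φ → begin
    pair ((c , e) ∷ r ++ (d , e) ∷ r′) φ
      ≡⟨ cong (λ x → c ℤ.* φ e ℤ.+ x) (pair-++ r ((d , e) ∷ r′) φ) ⟩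
    c ℤ.* φ e ℤ.+ (pair r φ ℤ.+ (d ℤ.* φ e ℤ.+ pair r′ φ))
      ≡⟨ solve 5 (λ c d x s t → c :* x :+ (s :+ (d :* x :+ t)) := (c :+ d) :* x :+ (s :+ t)) refl
           c d (φ e) (pair r φ) (pair r′ φ) ⟩
    (c ℤ.+ d) ℤ.* φ e ℤ.+ (pair r φ ℤ.+ pair r′ φ)
      ≡⟨ cong (λ x → (c ℤ.+ d) ℤ.* φ e ℤ.+ x) (sym (pair-++ r r′ φ)) ⟩
    pair ((c ℤ.+ d , e) ∷ (r ++ r′)) φ ∎))
  where open ≡-Reasoning
        open +-*-Solver

below-shift : ∀ c h {e q} → Below e q →
  Below (addE h e) (map (λ s → (c ℤ.* proj₁ s , addE h (proj₂ s))) q)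
below-shift c h b = AllP.map⁺ (All.map (addE-monoʳ h) b)

below-* : ∀ {e g d p q} → Below e p → Below g q → Below (addE e g) (p *L ((d , g) ∷ q))
below-* [] b′ = []
below-* {e} {g} {d} {(c , h) ∷ p} {q} (k ∷ b) b′ =
  AllP.++⁺ (k′ ∷ All.map (λ l → <E-trans l k′) (below-shift c h b′)) (below-* b b′)
  where
  k′ : addE h g <E addE e g
  k′ = subst (_<E addE e g) (addE-comm g h) (subst (addE g h <E_) (addE-comm g e) (addE-monoʳ g k))

-- The list product of the two split forms starts with the product of the heads. In every other term
-- at least one factor lies strictly below its head, and the order is translation invariant.
lead-* : ∀ {p q e g c d} → Lead p e c → Lead q g d → Lead (p *L q) (addE e g) (c ℤ.* d)
lead-* {e = e} {c = c} (lead b s) (lead b′ s′) =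
  lead (AllP.++⁺ (below-shift c e b′) (below-* b b′)) (*L-cong s s′)

lead-exists : ∀ p → p ≋ 0L ⊎ (Σ Exp λ e → Σ ℤ λ c → c ≢ + 0 × Lead p e c)
lead-exists p with normalise p
... | [] , _ , eq = inj₁ eq
... | (c , e) ∷ q , cons c≢0 b _ , eq = inj₂ (e , c , c≢0 , lead b eq)

*-nonzero : ∀ {c d} → c ≢ + 0 → d ≢ + 0 → c ℤ.* d ≢ + 0
*-nonzero {c} c≢0 d≢0 z with ℤP.i*j≡0⇒i≡0∨j≡0 c z
... | inj₁ h = c≢0 h
... | inj₂ h = d≢0 h

-- The product of the leading coefficients is a coefficient of the product, so `L` inherits being a
-- domain from ℤ.
*L-zero-divisor : ∀ {p q} → ¬ (p ≋ 0L) → p *L q ≋ 0L → q ≋ 0L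
*L-zero-divisor {p} {q} p≢0 z with lead-exists p | lead-exists q
... | inj₁ h | _ = ⊥-elim (p≢0 h)
... | inj₂ _ | inj₁ h = h
... | inj₂ (e , c , c≢0 , l) | inj₂ (g , d , d≢0 , m) =
  ⊥-elim (*-nonzero c≢0 d≢0 (trans (sym (lead-coeff (lead-* l m))) (≋⇒≈ z (addE e g))))

-- Ring identities and 2×2 matrices

ℤ-rawRing : RawRing 0ℓ 0ℓ
ℤ-rawRing = CommutativeRing.rawRing ℤP.+-*-commutativeRing

-- Stated over an abstract ring so that the solver never unfolds Laurent polynomials.
module Identities (R : CommutativeRing 0ℓ 0ℓ)
                  (hom : ℤ-rawRing -Raw-AlmostCommutative⟶ fromCommutativeRing R) where

  open CommutativeRing R renaming (refl to ≈-refl; sym to ≈-sym; trans to ≈-trans)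

  coefficient≟ : WeaklyDecidable (Induced-equivalence hom)
  coefficient≟ a b with a ℤ.≟ b
  ... | yes refl = just ≈-refl
  ... | no _ = nothing

  open RingSolver ℤ-rawRing (fromCommutativeRing R) hom coefficient≟

  assoc-entry : ∀ r s a b c d u v →
    (r * a + s * c) * u + (r * b + s * d) * v ≈ r * (a * u + b * v) + s * (c * u + d * v)
  assoc-entry = solve 8 (λ r s a b c d u v →
    (r :* a :+ s :* c) :* u :+ (r :* b :+ s :* d) :* v := r :* (a :* u :+ b :* v) :+ s :* (c :* u :+ d :* v)) ≈-refl

  adj-diag : ∀ a b c d → d * a + (- b) * c ≈ a * d - b * c
  adj-diag = solve 4 (λ a b c d → d :* a :+ (:- b) :* c := a :* d :- b :* c) ≈-refl

  adj-diag′ : ∀ a b c d → (- c) * b + a * d ≈ a * d - b * c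
  adj-diag′ = solve 4 (λ a b c d → (:- c) :* b :+ a :* d := a :* d :- b :* c) ≈-refl

  adjʳ-diag : ∀ a b c d → a * d + b * (- c) ≈ a * d - b * c
  adjʳ-diag = solve 4 (λ a b c d → a :* d :+ b :* (:- c) := a :* d :- b :* c) ≈-refl

  adjʳ-diag′ : ∀ a b c d → c * (- b) + d * a ≈ a * d - b * c
  adjʳ-diag′ = solve 4 (λ a b c d → c :* (:- b) :+ d :* a := a :* d :- b :* c) ≈-refl

  adj-off : ∀ a b → a * b + (- b) * a ≈ 0#
  adj-off a b = ≈-trans (solve 2 (λ a b → a :* b :+ (:- b) :* a := con (+ 0)) ≈-refl a b) 0-homo
    where open _-Raw-AlmostCommutative⟶_ hom

  adj-off′ : ∀ a b → (- b) * a + a * b ≈ 0#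
  adj-off′ a b = ≈-trans (+-comm _ _) (adj-off a b)

  adjʳ-off : ∀ a b → a * (- b) + b * a ≈ 0#
  adjʳ-off a b = ≈-trans (+-cong (*-comm _ _) (*-comm _ _)) (adj-off′ a b)

  adjʳ-off′ : ∀ a b → b * a + a * (- b) ≈ 0#
  adjʳ-off′ a b = ≈-trans (+-comm _ _) (adjʳ-off a b)

  det-adj : ∀ a b c d → d * a - (- b) * (- c) ≈ a * d - b * c
  det-adj = solve 4 (λ a b c d → d :* a :- (:- b) :* (:- c) := a :* d :- b :* c) ≈-refl

  det-product : ∀ a b c d a′ b′ c′ d′ →
    (a * a′ + b * c′) * (c * b′ + d * d′) - (a * b′ + b * d′) * (c * a′ + d * c′)
      ≈ (a * d - b * c) * (a′ * d′ - b′ * c′)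
  det-product = solve 8 (λ a b c d a′ b′ c′ d′ →
    (a :* a′ :+ b :* c′) :* (c :* b′ :+ d :* d′) :- (a :* b′ :+ b :* d′) :* (c :* a′ :+ d :* c′)
      := (a :* d :- b :* c) :* (a′ :* d′ :- b′ :* c′)) ≈-refl

  tr-swap : ∀ a b c d a′ b′ c′ d′ →
    (a * a′ + b * c′) + (c * b′ + d * d′) ≈ (a′ * a + b′ * c) + (c′ * b + d′ * d)
  tr-swap = solve 8 (λ a b c d a′ b′ c′ d′ →
    (a :* a′ :+ b :* c′) :+ (c :* b′ :+ d :* d′) := (a′ :* a :+ b′ :* c) :+ (c′ :* b :+ d′ :* d)) ≈-refl

  -- The origin of the exchange relation. With s the (1,2)-entry of the product of the two matrices,
  -- the right-hand side is b² det + s² - bs tr, for the determinant and trace of the second matrix;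
  -- at determinant 1 and trace -k it becomes b² + kbs + s².
  conj-12 : ∀ a b c d a′ b′ c′ d′ →
    ((a * a′ + b * c′) * (- b) + (a * b′ + b * d′) * a) * b′
      ≈ (a′ * d′ - b′ * c′) * (b * b) + (a * b′ + b * d′) * (a * b′ + b * d′)
        - b * (a * b′ + b * d′) * (a′ + d′)
  conj-12 = solve 8 (λ a b c d a′ b′ c′ d′ →
    ((a :* a′ :+ b :* c′) :* (:- b) :+ (a :* b′ :+ b :* d′) :* a) :* b′
      := (a′ :* d′ :- b′ :* c′) :* (b :* b) :+ (a :* b′ :+ b :* d′) :* (a :* b′ :+ b :* d′)
        :- b :* (a :* b′ :+ b :* d′) :* (a′ :+ d′)) ≈-refl

  -- The mirror image: the first matrix is conjugated by the inverse of the second.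
  conj⁻-12 : ∀ a b c d a′ b′ c′ d′ →
    ((d′ * a + (- b′) * c) * b′ + (d′ * b + (- b′) * d) * d′) * b
      ≈ (a * d - b * c) * (b′ * b′) + (a * b′ + b * d′) * (a * b′ + b * d′)
        - b′ * (a * b′ + b * d′) * (a + d)
  conj⁻-12 = solve 8 (λ a b c d a′ b′ c′ d′ →
    ((d′ :* a :+ (:- b′) :* c) :* b′ :+ (d′ :* b :+ (:- b′) :* d) :* d′) :* b
      := (a :* d :- b :* c) :* (b′ :* b′) :+ (a :* b′ :+ b :* d′) :* (a :* b′ :+ b :* d′)
        :- b′ :* (a :* b′ :+ b :* d′) :* (a :+ d)) ≈-refl

  neg-mul-neg : ∀ a b → (- a) * (- b) ≈ a * b
  neg-mul-neg = solve 2 (λ a b → (:- a) :* (:- b) := a :* b) ≈-refl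

  exchange-form : ∀ u v k → u * u + v * v - u * v * (- k) ≈ u * u + k * u * v + v * v
  exchange-form = solve 3 (λ u v k → u :* u :+ v :* v :- u :* v :* (:- k) := u :* u :+ k :* u :* v :+ v :* v) ≈-refl

  exchange-symm : ∀ u v k → u * u + k * u * v + v * v ≈ v * v + k * v * u + u * u
  exchange-symm = solve 3 (λ u v k → u :* u :+ k :* u :* v :+ v :* v := v :* v :+ k :* v :* u :+ u :* u) ≈-refl

  cancel-sub : ∀ a p q → a * (p - q) ≈ a * p - a * q
  cancel-sub = solve 3 (λ a p q → a :* (p :- q) := a :* p :- a :* q) ≈-refl

  -- An ideal-membership argument: `r` is the multiplier with which the relation `u ≈ v` carries `p`
  -- into `q`. Nested uses combine several relations, and the innermost premise is a plain ring
  -- identity.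
  modulo : ∀ r {p q u v} → p ≈ q + r * (u - v) → u ≈ v → p ≈ q
  modulo r {p} {q} {u} {v} h e = ≈-trans h
    (≈-trans (+-congˡ (≈-trans (*-congˡ (≈-trans (+-congʳ e) (-‿inverseʳ v))) (zeroʳ r))) (+-identityʳ q))

  modulo₁ : ∀ {p q u v} → p ≈ q + (u - v) → u ≈ v → p ≈ q
  modulo₁ h = modulo 1# (≈-trans h (+-congˡ (≈-sym (*-identityˡ _))))

  X-22 : ∀ f d k → f + d ≈ - k → d ≈ (- f) - k
  X-22 f d k = modulo₁ (solve 3 (λ f d k → d := (:- f) :- k :+ ((f :+ d) :- (:- k))) ≈-refl f d k)

  -- The premise is (XY)₁₂ = z₁₂ with x₁₁ = `f`.
  Y-22 : ∀ f y₁ y₂ y₃ d → f * y₂ + y₁ * d ≈ y₃ → d * y₁ ≈ (- f) * y₂ + y₃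
  Y-22 f y₁ y₂ y₃ d h = ≈-trans
    (solve 4 (λ f y₁ y₂ d → d :* y₁ := (:- f) :* y₂ :+ (f :* y₂ :+ y₁ :* d)) ≈-refl f y₁ y₂ d) (+-congˡ h)

  Y-11 : ∀ f y₁ y₂ y₃ a d k → d * y₁ ≈ (- f) * y₂ + y₃ → a + d ≈ - k →
    a * y₁ ≈ f * y₂ - k * y₁ - y₃
  Y-11 f y₁ y₂ y₃ a d k h t = modulo y₁ (modulo₁ (solve 7 (λ f y₁ y₂ y₃ a d k →
    a :* y₁ := f :* y₂ :- k :* y₁ :- y₃ :+ y₁ :* (a :+ d :- :- k) :+ ((:- f) :* y₂ :+ y₃ :- d :* y₁))
    ≈-refl f y₁ y₂ y₃ a d k) (≈-sym h)) t

  -- The second premise is (YZ)₁₂ = x₁₂. Multiplied by `y₁`, it contains `a * y₁`, which the first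
  -- premise replaces.
  Z-22 : ∀ f y₁ y₂ y₃ a d k → a * y₁ ≈ f * y₂ - k * y₁ - y₃ → a * y₃ + y₂ * d ≈ y₁ →
    d * (y₁ * y₂) ≈ (- f) * y₂ * y₃ + k * y₁ * y₃ + y₁ * y₁ + y₃ * y₃
  Z-22 f y₁ y₂ y₃ a d k h e = modulo y₁ (modulo (- y₃) (solve 7 (λ f y₁ y₂ y₃ a d k →
    d :* (y₁ :* y₂) := (:- f) :* y₂ :* y₃ :+ k :* y₁ :* y₃ :+ y₁ :* y₁ :+ y₃ :* y₃
      :+ y₁ :* (a :* y₃ :+ y₂ :* d :- y₁) :+ (:- y₃) :* (a :* y₁ :- (f :* y₂ :- k :* y₁ :- y₃)))
    ≈-refl f y₁ y₂ y₃ a d k) h) e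

  Z-11 : ∀ f y₁ y₂ y₃ a d k k′ →
    d * (y₁ * y₂) ≈ (- f) * y₂ * y₃ + k * y₁ * y₃ + y₁ * y₁ + y₃ * y₃ → a + d ≈ - k′ →
    a * (y₁ * y₂) ≈ f * y₂ * y₃ - k′ * y₁ * y₂ - k * y₁ * y₃ - y₁ * y₁ - y₃ * y₃
  Z-11 f y₁ y₂ y₃ a d k k′ h t = modulo (y₁ * y₂) (modulo₁ (solve 8 (λ f y₁ y₂ y₃ a d k k′ →
    a :* (y₁ :* y₂) := f :* y₂ :* y₃ :- k′ :* y₁ :* y₂ :- k :* y₁ :* y₃ :- y₁ :* y₁ :- y₃ :* y₃
      :+ y₁ :* y₂ :* (a :+ d :- :- k′)
      :+ ((:- f) :* y₂ :* y₃ :+ k :* y₁ :* y₃ :+ y₁ :* y₁ :+ y₃ :* y₃ :- d :* (y₁ :* y₂)))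
    ≈-refl f y₁ y₂ y₃ a d k k′) (≈-sym h)) t

  -- The diagonal entries are known only after multiplication by the denominator, so the trace
  -- appears multiplied by `y₁`, a factor that is cancelled later in the domain `L`.
  Y-trace : ∀ f y₁ y₂ y₃ a d k → a * y₁ ≈ f * y₂ - k * y₁ - y₃ → d * y₁ ≈ (- f) * y₂ + y₃ →
    y₁ * (a + d) ≈ y₁ * (- k)
  Y-trace f y₁ y₂ y₃ a d k h h′ = modulo₁ (modulo₁ (solve 7 (λ f y₁ y₂ y₃ a d k →
    y₁ :* (a :+ d) := y₁ :* (:- k) :+ (a :* y₁ :- (f :* y₂ :- k :* y₁ :- y₃)) :+ (d :* y₁ :- ((:- f) :* y₂ :+ y₃)))
    ≈-refl f y₁ y₂ y₃ a d k) h′) h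

  Z-trace : ∀ f y₁ y₂ y₃ a d k k′ →
    a * (y₁ * y₂) ≈ f * y₂ * y₃ - k′ * y₁ * y₂ - k * y₁ * y₃ - y₁ * y₁ - y₃ * y₃ →
    d * (y₁ * y₂) ≈ (- f) * y₂ * y₃ + k * y₁ * y₃ + y₁ * y₁ + y₃ * y₃ →
    y₁ * y₂ * (a + d) ≈ y₁ * y₂ * (- k′)
  Z-trace f y₁ y₂ y₃ a d k k′ h h′ = modulo₁ (modulo₁ (solve 8 (λ f y₁ y₂ y₃ a d k k′ →
    y₁ :* y₂ :* (a :+ d) := y₁ :* y₂ :* (:- k′)
      :+ (a :* (y₁ :* y₂) :- (f :* y₂ :* y₃ :- k′ :* y₁ :* y₂ :- k :* y₁ :* y₃ :- y₁ :* y₁ :- y₃ :* y₃))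
      :+ (d :* (y₁ :* y₂) :- ((:- f) :* y₂ :* y₃ :+ k :* y₁ :* y₃ :+ y₁ :* y₁ :+ y₃ :* y₃)))
    ≈-refl f y₁ y₂ y₃ a d k k′) h′) h

  X-trace : ∀ f k → f + ((- f) - k) ≈ - k
  X-trace = solve 2 (λ f k → f :+ ((:- f) :- k) := :- k) ≈-refl

  neg-neg : ∀ a → a ≈ - (- a)
  neg-neg = solve 1 (λ a → a := :- (:- a)) ≈-refl

  scale-unit : ∀ {u b s t} → u ≈ 1# → u * b + s + t ≈ b + s + t
  scale-unit h = +-congʳ (+-congʳ (≈-trans (*-congʳ h) (*-identityˡ _)))

  sub-product-cong : ∀ p b {s s′ t t′} → s ≈ s′ → t ≈ t′ → p + s * s - b * s * t ≈ p + s′ * s′ - b * s′ * t′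
  sub-product-cong p b h h′ = +-cong (+-congˡ (*-cong h h)) (-‿cong (*-cong (*-congˡ h) h′))

ℤ⟶L : ℤ-rawRing -Raw-AlmostCommutative⟶ fromCommutativeRing L-commutativeRing
ℤ⟶L = record
  { ⟦_⟧ = cst ; +-homo = cst-+ ; *-homo = cst-* ; -‿homo = cst-neg ; 0-homo = cst-0 ; 1-homo = ≋-refl }

module I = Identities L-commutativeRing ℤ⟶L
module LR = CommutativeRing L-commutativeRing

*L-cancelˡ : ∀ {a p q} → ¬ (a ≋ 0L) → a *L p ≋ a *L q → p ≋ q
*L-cancelˡ {a} {p} {q} a≢0 h = -≋0⇒≋ p q (*L-zero-divisor a≢0
  (≋-trans (I.cancel-sub a p q) (≋-trans (+L-cong h (≋-refl { -L (a *L q)})) (LR.-‿inverseʳ (a *L q)))))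

infix 4 _≋M_
record _≋M_ (A B : M2) : Set where
  constructor entries
  field
    ≋11 : m11 A ≋ m11 B
    ≋12 : m12 A ≋ m12 B
    ≋21 : m21 A ≋ m21 B
    ≋22 : m22 A ≋ m22 B
open _≋M_ public

≈M⇒≋M : ∀ {A B} → A ≈M B → A ≋M B
≈M⇒≋M (a , b , c , d) = entries (≈⇒≋ a) (≈⇒≋ b) (≈⇒≋ c) (≈⇒≋ d)

≋M⇒≈M : ∀ {A B} → A ≋M B → A ≈M B
≋M⇒≈M (entries a b c d) = ≋⇒≈ a , ≋⇒≈ b , ≋⇒≈ c , ≋⇒≈ d

≋M-refl : ∀ {A} → A ≋M A
≋M-refl = entries ≋-refl ≋-refl ≋-refl ≋-refl

≋M-sym : ∀ {A B} → A ≋M B → B ≋M A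
≋M-sym (entries a b c d) = entries (≋-sym a) (≋-sym b) (≋-sym c) (≋-sym d)

≋M-trans : ∀ {A B C} → A ≋M B → B ≋M C → A ≋M C
≋M-trans (entries a b c d) (entries a′ b′ c′ d′) =
  entries (≋-trans a a′) (≋-trans b b′) (≋-trans c c′) (≋-trans d d′)

·-cong : ∀ {A A′ B B′} → A ≋M A′ → B ≋M B′ → A · B ≋M A′ · B′
·-cong (entries a b c d) (entries a′ b′ c′ d′) = entries
  (+L-cong (*L-cong a a′) (*L-cong b c′)) (+L-cong (*L-cong a b′) (*L-cong b d′))
  (+L-cong (*L-cong c a′) (*L-cong d c′)) (+L-cong (*L-cong c b′) (*L-cong d d′))

·-congˡ : ∀ A {B B′} → B ≋M B′ → A · B ≋M A · B′
·-congˡ A = ·-cong (≋M-refl {A})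

·-congʳ : ∀ {A A′} B → A ≋M A′ → A · B ≋M A′ · B
·-congʳ B h = ·-cong h (≋M-refl {B})

inv-cong : ∀ {A A′} → A ≋M A′ → inv A ≋M inv A′
inv-cong (entries a b c d) = entries d (-L-cong b) (-L-cong c) a

·-assoc : ∀ A B C → (A · B) · C ≋M A · (B · C)
·-assoc (mat a b c d) (mat a′ b′ c′ d′) (mat a″ b″ c″ d″) = entries
  (I.assoc-entry a b a′ b′ c′ d′ a″ c″) (I.assoc-entry a b a′ b′ c′ d′ b″ d″)
  (I.assoc-entry c d a′ b′ c′ d′ a″ c″) (I.assoc-entry c d a′ b′ c′ d′ b″ d″)

1M : M2
1M = mat 1L 0L 0L 1L

·-identityˡ : ∀ A → 1M · A ≋M A
·-identityˡ (mat a b c d) = entries (lemma a) (lemma b) (*L-identityˡ c) (*L-identityˡ d)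
  where
  lemma : ∀ p → 1L *L p +L 0L ≋ p
  lemma p = ≋-trans (+L-identityʳ (1L *L p)) (*L-identityˡ p)

·-identityʳ : ∀ A → A · 1M ≋M A
·-identityʳ (mat a b c d) = entries (lemma a b) (lemma′ a b) (lemma c d) (lemma′ c d)
  where
  lemma : ∀ p q → p *L 1L +L q *L 0L ≋ p
  lemma p q = ≋-trans (+L-cong (LR.*-identityʳ p) (LR.zeroʳ q)) (+L-identityʳ p)
  lemma′ : ∀ p q → p *L 0L +L q *L 1L ≋ q
  lemma′ p q = +L-cong (LR.zeroʳ p) (LR.*-identityʳ q)

inv-·ˡ : ∀ A → det A ≋ 1L → inv A · A ≋M 1M
inv-·ˡ (mat a b c d) h = entries
  (≋-trans (I.adj-diag a b c d) h) (I.adj-off d b)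
  (I.adj-off′ a c) (≋-trans (I.adj-diag′ a b c d) h)

inv-·ʳ : ∀ A → det A ≋ 1L → A · inv A ≋M 1M
inv-·ʳ (mat a b c d) h = entries
  (≋-trans (I.adjʳ-diag a b c d) h) (I.adjʳ-off a b)
  (I.adjʳ-off′ d c) (≋-trans (I.adjʳ-diag′ a b c d) h)

inv-cancelˡ : ∀ A B → det A ≋ 1L → inv A · (A · B) ≋M B
inv-cancelˡ A B h =
  ≋M-trans (≋M-sym (·-assoc (inv A) A B)) (≋M-trans (·-congʳ B (inv-·ˡ A h)) (·-identityˡ B))

inv-cancelˡ′ : ∀ A B → det A ≋ 1L → A · (inv A · B) ≋M B
inv-cancelˡ′ A B h =
  ≋M-trans (≋M-sym (·-assoc A (inv A) B)) (≋M-trans (·-congʳ B (inv-·ʳ A h)) (·-identityˡ B))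

inv-cancelʳ : ∀ A B → det A ≋ 1L → (B · A) · inv A ≋M B
inv-cancelʳ A B h =
  ≋M-trans (·-assoc B A (inv A)) (≋M-trans (·-congˡ B (inv-·ʳ A h)) (·-identityʳ B))

inv-cancelʳ′ : ∀ A B → det A ≋ 1L → (B · inv A) · A ≋M B
inv-cancelʳ′ A B h =
  ≋M-trans (·-assoc B (inv A) A) (≋M-trans (·-congˡ B (inv-·ˡ A h)) (·-identityʳ B))

conj conj⁻ : M2 → M2 → M2
conj A B = A · B · inv A
conj⁻ A B = inv A · B · A

conj-cong : ∀ {A A′ B B′} → A ≋M A′ → B ≋M B′ → conj A B ≋M conj A′ B′
conj-cong h h′ = ·-cong (·-cong h h′) (inv-cong h)

conj⁻-cong : ∀ {A A′ B B′} → A ≋M A′ → B ≋M B′ → conj⁻ A B ≋M conj⁻ A′ B′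
conj⁻-cong h h′ = ·-cong (·-cong (inv-cong h) h′) h

·-conj⁻ : ∀ A B → det A ≋ 1L → A · conj⁻ A B ≋M B · A
·-conj⁻ A B h = ≋M-trans (·-congˡ A (·-assoc (inv A) B A)) (inv-cancelˡ′ A (B · A) h)

conj-conj⁻ : ∀ A B → det A ≋ 1L → conj A (conj⁻ A B) ≋M B
conj-conj⁻ A B h = ≋M-trans (·-congʳ (inv A) (·-conj⁻ A B h)) (inv-cancelʳ A B h)

conj⁻-conj : ∀ A B → det A ≋ 1L → conj⁻ A (conj A B) ≋M B
conj⁻-conj A B h = ≋M-trans
  (·-congʳ A (≋M-trans (≋M-sym (·-assoc (inv A) (A · B) (inv A))) (·-congʳ (inv A) (inv-cancelˡ A B h))))
  (inv-cancelʳ′ A B h)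

det-· : ∀ A B → det (A · B) ≋ det A *L det B
det-· (mat a b c d) (mat a′ b′ c′ d′) = I.det-product a b c d a′ b′ c′ d′

det-inv : ∀ A → det (inv A) ≋ det A
det-inv (mat a b c d) = I.det-adj a b c d

unit-· : ∀ A B → det A ≋ 1L → det B ≋ 1L → det (A · B) ≋ 1L
unit-· A B h h′ = ≋-trans (det-· A B) (≋-trans (*L-cong h h′) (*L-identityˡ 1L))

unit-inv : ∀ A → det A ≋ 1L → det (inv A) ≋ 1L
unit-inv A h = ≋-trans (det-inv A) h

unit-conj : ∀ A B → det A ≋ 1L → det B ≋ 1L → det (conj A B) ≋ 1L
unit-conj A B h h′ = unit-· (A · B) (inv A) (unit-· A B h h′) (unit-inv A h)

unit-conj⁻ : ∀ A B → det A ≋ 1L → det B ≋ 1L → det (conj⁻ A B) ≋ 1L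
unit-conj⁻ A B h h′ = unit-· (inv A · B) A (unit-· (inv A) B (unit-inv A h) h′) h

tr-cong : ∀ {A B} → A ≋M B → tr A ≋ tr B
tr-cong (entries a _ _ d) = +L-cong a d

tr-·-comm : ∀ A B → tr (A · B) ≋ tr (B · A)
tr-·-comm (mat a b c d) (mat a′ b′ c′ d′) = I.tr-swap a b c d a′ b′ c′ d′

tr-conj : ∀ A B → det A ≋ 1L → tr (conj A B) ≋ tr B
tr-conj A B h = ≋-trans (tr-·-comm (A · B) (inv A)) (tr-cong (inv-cancelˡ A B h))

tr-conj⁻ : ∀ A B → det A ≋ 1L → tr (conj⁻ A B) ≋ tr B
tr-conj⁻ A B h = ≋-trans (tr-·-comm (inv A · B) A)
  (tr-cong (≋M-trans (≋M-sym (·-assoc A (inv A) B)) (≋M-trans (·-congʳ B (inv-·ʳ A h)) (·-identityˡ B))))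

conj-exchange : ∀ A B {s t} → det B ≋ 1L → m12 (A · B) ≋ s → tr B ≋ t →
  m12 (conj A B) *L m12 B ≋ m12 A *L m12 A +L s *L s -L m12 A *L s *L t
conj-exchange (mat a b c d) (mat a′ b′ c′ d′) {s} {t} h hs ht =
  ≋-trans (I.conj-12 a b c d a′ b′ c′ d′) (≋-trans (I.scale-unit h) (I.sub-product-cong (b *L b) b hs ht))

conj⁻-exchange : ∀ A B {s t} → det A ≋ 1L → m12 (A · B) ≋ s → tr A ≋ t →
  m12 (conj⁻ B A) *L m12 A ≋ m12 B *L m12 B +L s *L s -L m12 B *L s *L t
conj⁻-exchange (mat a b c d) (mat a′ b′ c′ d′) {s} {t} h hs ht =
  ≋-trans (I.conj⁻-12 a b c d a′ b′ c′ d′) (≋-trans (I.scale-unit h) (I.sub-product-cong (b′ *L b′) b′ hs ht))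

neg-neg-1 : ∀ p → (-L 1L) *L (-L p) ≋ p
neg-neg-1 p = ≋-trans (I.neg-mul-neg 1L p) (*L-identityˡ p)

-- Here XY = TZ⁻¹, and the first row of T is (-1, 0), so only -1 times the entry -z₁₂ of Z⁻¹
-- survives.
·-12-left : ∀ {k₁ k₂ k₃} X Y Z → det Z ≋ 1L → X · Y · Z ≋M T k₁ k₂ k₃ → m12 (X · Y) ≋ m12 Z
·-12-left {k₁} {k₂} {k₃} X Y Z h e =
  ≋-trans (≋12 (≋M-trans (≋M-sym (inv-cancelʳ Z (X · Y) h)) (·-congʳ (inv Z) e)))
    (≋-trans (+L-identityʳ _) (neg-neg-1 (m12 Z)))

-- Dually, YZ = X⁻¹T, and the second column of T is (0, -1).
·-12-right : ∀ {k₁ k₂ k₃} X Y Z → det X ≋ 1L → X · Y · Z ≋M T k₁ k₂ k₃ → m12 (Y · Z) ≋ m12 X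
·-12-right {k₁} {k₂} {k₃} X Y Z h e =
  ≋-trans (≋12 (≋M-trans (≋M-sym (inv-cancelˡ X (Y · Z) h)) (·-congˡ (inv X) (≋M-trans (≋M-sym (·-assoc X Y Z)) e))))
    (+L-cong (LR.zeroʳ (m22 X)) (≋-trans (*L-comm (-L m12 X) (-L 1L)) (neg-neg-1 (m12 X))))

-- Exchange polynomials and growth of values

exchange : L → L → L → L
exchange κ u v = u *L u +L κ *L u *L v +L v *L v

exchange-cong : ∀ κ {u u′ v v′} → u ≋ u′ → v ≋ v′ → exchange κ u v ≋ exchange κ u′ v′
exchange-cong κ hu hv =
  +L-cong (+L-cong (*L-cong hu hu) (*L-cong (*L-cong (≋-refl {κ}) hu) hv)) (*L-cong hv hv)

value-exchange : ∀ κ u v → ∣ exchange κ u v ∣L ≡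
  ∣ u ∣L ℤ.* ∣ u ∣L ℤ.+ ∣ κ ∣L ℤ.* ∣ u ∣L ℤ.* ∣ v ∣L ℤ.+ ∣ v ∣L ℤ.* ∣ v ∣L
value-exchange κ u v = begin
  ∣ exchange κ u v ∣L
    ≡⟨ value-+ (u *L u +L κ *L u *L v) (v *L v) ⟩
  ∣ u *L u +L κ *L u *L v ∣L ℤ.+ ∣ v *L v ∣L
    ≡⟨ cong₂ ℤ._+_ (value-+ (u *L u) (κ *L u *L v)) (value-* v v) ⟩
  ∣ u *L u ∣L ℤ.+ ∣ κ *L u *L v ∣L ℤ.+ ∣ v ∣L ℤ.* ∣ v ∣L
    ≡⟨ cong (ℤ._+ ∣ v ∣L ℤ.* ∣ v ∣L) (cong₂ ℤ._+_ (value-* u u)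
         (trans (value-* (κ *L u) v) (cong (ℤ._* ∣ v ∣L) (value-* κ u)))) ⟩
  ∣ u ∣L ℤ.* ∣ u ∣L ℤ.+ ∣ κ ∣L ℤ.* ∣ u ∣L ℤ.* ∣ v ∣L ℤ.+ ∣ v ∣L ℤ.* ∣ v ∣L ∎
  where open ≡-Reasoning

*-nonNeg : ∀ {a b} → + 0 ℤ.≤ a → + 0 ℤ.≤ b → + 0 ℤ.≤ a ℤ.* b
*-nonNeg {+ m} {+ n} _ _ = subst (+ 0 ℤ.≤_) (ℤP.pos-* m n) (+≤+ z≤n)

*-pos : ∀ {a b} → + 0 ℤ.< a → + 0 ℤ.< b → + 0 ℤ.< a ℤ.* b
*-pos {a} {b} ha hb = subst (ℤ._< a ℤ.* b) (ℤP.*-zeroʳ a) (ℤP.*-monoˡ-<-pos a ⦃ ℤ.positive ha ⦄ hb)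

pos-divisor : ∀ {a b} → + 0 ℤ.< b → + 0 ℤ.< a ℤ.* b → + 0 ℤ.< a
pos-divisor {a} {b} hb h =
  ℤP.*-cancelʳ-<-nonNeg b ⦃ ℤ.nonNegative (ℤP.<⇒≤ hb) ⦄ h

-- If x ≤ u, then xw ≤ uw ≤ u², whereas the exchange polynomial is at least u² + v² > u².
exchange-growth : ∀ {x w u v k} → + 0 ℤ.< w → + 0 ℤ.< u → + 0 ℤ.< v → + 0 ℤ.≤ k → w ℤ.≤ u →
  x ℤ.* w ≡ u ℤ.* u ℤ.+ k ℤ.* u ℤ.* v ℤ.+ v ℤ.* v → u ℤ.< x
exchange-growth {x} {w} {u} {v} {k} w>0 u>0 v>0 k≥0 w≤u e = ℤP.≰⇒> λ x≤u → ℤP.<-irrefl refl (begin-strict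
  x ℤ.* w    ≤⟨ ℤP.*-monoʳ-≤-nonNeg w ⦃ ℤ.nonNegative (ℤP.<⇒≤ w>0) ⦄ x≤u ⟩
  u ℤ.* w    ≤⟨ ℤP.*-monoˡ-≤-nonNeg u ⦃ ℤ.nonNegative (ℤP.<⇒≤ u>0) ⦄ w≤u ⟩
  u ℤ.* u    ≡⟨ sym (ℤP.+-identityʳ (u ℤ.* u)) ⟩
  u ℤ.* u ℤ.+ + 0
    ≤⟨ ℤP.+-monoʳ-≤ (u ℤ.* u) (*-nonNeg (*-nonNeg k≥0 (ℤP.<⇒≤ u>0)) (ℤP.<⇒≤ v>0)) ⟩
  u ℤ.* u ℤ.+ k ℤ.* u ℤ.* v
    ≡⟨ sym (ℤP.+-identityʳ (u ℤ.* u ℤ.+ k ℤ.* u ℤ.* v)) ⟩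
  u ℤ.* u ℤ.+ k ℤ.* u ℤ.* v ℤ.+ + 0
    <⟨ ℤP.+-monoʳ-< (u ℤ.* u ℤ.+ k ℤ.* u ℤ.* v) (*-pos v>0 v>0) ⟩
  u ℤ.* u ℤ.+ k ℤ.* u ℤ.* v ℤ.+ v ℤ.* v ≡⟨ sym e ⟩
  x ℤ.* w    ∎)
  where open ℤP.≤-Reasoning

exchange-value-growth : ∀ κ x w u v → + 0 ℤ.≤ ∣ κ ∣L → x *L w ≋ exchange κ u v →
  + 0 ℤ.< ∣ w ∣L → + 0 ℤ.< ∣ u ∣L → + 0 ℤ.< ∣ v ∣L → ∣ w ∣L ℤ.≤ ∣ u ∣L → ∣ u ∣L ℤ.< ∣ x ∣L
exchange-value-growth κ x w u v κ≥0 e w>0 u>0 v>0 w≤u =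
  exchange-growth {w = ∣ w ∣L} {k = ∣ κ ∣L} w>0 u>0 v>0 κ≥0 w≤u
    (trans (sym (value-* x w)) (trans (value-cong e) (value-exchange κ u v)))

-- Leading exponents of cluster variables

pos≢0 : ∀ {c} → + 0 ℤ.< c → c ≢ + 0
pos≢0 h e = ℤP.<-irrefl (sym e) h

lead-cst : ∀ c → Lead (cst c) zeroE c
lead-cst c = lead [] ≋-refl

lead-exchange : ∀ n {u v g c d} → Lead u g c → Lead v g d →
  Lead (exchange (cN n) u v) (addE g g) (c ℤ.* c ℤ.+ + n ℤ.* c ℤ.* d ℤ.+ d ℤ.* d)
lead-exchange n {g = g} lu lv =
  lead-+ (lead-+ (lead-* lu lu)
    (subst (λ e → Lead _ (addE e g) _) (addE-identityˡ g) (lead-* (lead-* (lead-cst (+ n)) lu) lv)))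
    (lead-* lv lv)

-- If the leading exponents differ, the smaller one is raised with coefficient 0, and the square of
-- the larger leading term remains. If they agree, the three contributions are nonnegative and
-- cannot cancel, thanks to `c` and `d` being positive. Either way the exponent is a double.
lead-exchange-pos : ∀ n {u v e g c d} → + 0 ℤ.< c → + 0 ℤ.< d → Lead u e c → Lead v g d →
  Σ Exp λ f → Σ ℤ λ b → + 0 ℤ.< b × Lead (exchange (cN n) u v) (addE f f) b
lead-exchange-pos n {e = e} {g} {c} {d} c>0 d>0 lu lv with <E-cmp e g
... | inj₁ h = g , _ , subst (+ 0 ℤ.<_) (eq c d (+ n)) (*-pos d>0 d>0) , lead-exchange n (lead-raise h lu) lv
  where
  open +-*-Solver
  eq : ∀ c d n → d ℤ.* d ≡ + 0 ℤ.* + 0 ℤ.+ n ℤ.* + 0 ℤ.* d ℤ.+ d ℤ.* d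
  eq = solve 3 (λ c d n → d :* d := con (+ 0) :* con (+ 0) :+ n :* con (+ 0) :* d :+ d :* d) refl
... | inj₂ (inj₂ h) = e , _ , subst (+ 0 ℤ.<_) (eq c d (+ n)) (*-pos c>0 c>0) , lead-exchange n lu (lead-raise h lv)
  where
  open +-*-Solver
  eq : ∀ c d n → c ℤ.* c ≡ c ℤ.* c ℤ.+ n ℤ.* c ℤ.* + 0 ℤ.+ + 0 ℤ.* + 0
  eq = solve 3 (λ c d n → c :* c := c :* c :+ n :* c :* con (+ 0) :+ con (+ 0) :* con (+ 0)) refl
... | inj₂ (inj₁ refl) = e , _ ,
  ℤP.+-mono-<-≤ (ℤP.+-mono-<-≤ (*-pos c>0 c>0)
    (*-nonNeg (*-nonNeg (+≤+ {n = n} z≤n) (ℤP.<⇒≤ c>0)) (ℤP.<⇒≤ d>0))) (ℤP.<⇒≤ (*-pos d>0 d>0)) ,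
  lead-exchange n lu lv

-- Leading terms multiply, so the quotient has leading exponent f - e, and its leading coefficient
-- is positive because its product with `c` is `d`.
lead-quotient : ∀ {a′ a p e c f d} → + 0 ℤ.< c → + 0 ℤ.< d → a′ *L a ≋ p → Lead a e c → Lead p f d →
  Σ Exp λ e′ → Σ ℤ λ c′ → + 0 ℤ.< c′ × Lead a′ e′ c′ × addE e′ e ≡ f
lead-quotient {a′} {a} {p} {e} {c} {f} {d} c>0 d>0 h la lp with lead-exists a′
... | inj₁ z = ⊥-elim (pos≢0 d>0 (trans (sym (lead-coeff lp))
  (≋⇒≈ (≋-trans (≋-sym h) (*L-cong z (≋-refl {a}))) f)))
... | inj₂ (e′ , c′ , c′≢0 , la′)
  with lead-unique (*-nonzero c′≢0 (pos≢0 c>0)) (pos≢0 d>0) (lead-cong h (lead-* la′ la)) lp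
... | eqE , eqC = e′ , c′ , pos-divisor {c′} c>0 (subst (+ 0 ℤ.<_) (sym eqC) d>0) , la′ , eqE

unitE : Fin 3 → Exp
unitE zero = (+ 1 , + 0 , + 0)
unitE (suc zero) = (+ 0 , + 1 , + 0)
unitE (suc (suc zero)) = (+ 0 , + 0 , + 1)

-- Congruence to `unitE i` modulo 2, with `half` as witness. Positivity of the coefficient is
-- carried along because it excludes cancellation in exchange polynomials.
record ParityLead (i : Fin 3) (p : L) : Set where
  constructor parityLead
  field
    half : Exp
    coefficient : ℤ
    coefficient>0 : + 0 ℤ.< coefficient
    isLead : Lead p (addE (unitE i) (addE half half)) coefficient

odd≢even : ∀ h g → + 1 ℤ.+ (h ℤ.+ h) ≢ + 0 ℤ.+ (g ℤ.+ g)
odd≢even h g e = absurd ℤ.∣ g ℤ.- h ∣ (trans (cong ℤ.∣_∣ one≡) (ℤP.abs-* (+ 2) (g ℤ.- h)))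
  where
  open +-*-Solver
  one≡ : + 1 ≡ + 2 ℤ.* (g ℤ.- h)
  one≡ = begin
    + 1                                        ≡⟨ solve 1 (λ h → con (+ 1) := con (+ 1) :+ (h :+ h) :- (h :+ h)) refl h ⟩
    + 1 ℤ.+ (h ℤ.+ h) ℤ.- (h ℤ.+ h)            ≡⟨ cong (ℤ._- (h ℤ.+ h)) e ⟩
    + 0 ℤ.+ (g ℤ.+ g) ℤ.- (h ℤ.+ h)
      ≡⟨ solve 2 (λ g h → con (+ 0) :+ (g :+ g) :- (h :+ h) := con (+ 2) :* (g :- h)) refl g h ⟩
    + 2 ℤ.* (g ℤ.- h)                          ∎
    where open ≡-Reasoning
  absurd : ∀ n → 1 ≢ 2 ℕ.* n
  absurd zero ()
  absurd (suc n) h with trans h (cong suc (+-suc n (n ℕ.+ 0)))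
  ... | ()

unitE-parity : ∀ i j h g → addE (unitE i) (addE h h) ≡ addE (unitE j) (addE g g) → i ≡ j
unitE-parity zero zero _ _ _ = refl
unitE-parity zero (suc zero) (h , _) (g , _) e = ⊥-elim (odd≢even h g (cong proj₁ e))
unitE-parity zero (suc (suc zero)) (h , _) (g , _) e = ⊥-elim (odd≢even h g (cong proj₁ e))
unitE-parity (suc zero) zero (h , _) (g , _) e = ⊥-elim (odd≢even g h (sym (cong proj₁ e)))
unitE-parity (suc zero) (suc zero) _ _ _ = refl
unitE-parity (suc zero) (suc (suc zero)) (_ , h , _) (_ , g , _) e =
  ⊥-elim (odd≢even h g (cong (λ t → proj₁ (proj₂ t)) e))
unitE-parity (suc (suc zero)) zero (h , _) (g , _) e = ⊥-elim (odd≢even g h (sym (cong proj₁ e)))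
unitE-parity (suc (suc zero)) (suc zero) (_ , h , _) (_ , g , _) e =
  ⊥-elim (odd≢even g h (sym (cong (λ t → proj₁ (proj₂ t)) e)))
unitE-parity (suc (suc zero)) (suc (suc zero)) _ _ _ = refl

parityLead-unique : ∀ {i j p q} → p ≋ q → ParityLead i p → ParityLead j q → i ≡ j
parityLead-unique {i} {j} e (parityLead h c c>0 l) (parityLead g d d>0 m) =
  unitE-parity i j h g (proj₁ (lead-unique (pos≢0 c>0) (pos≢0 d>0) (lead-cong e l) m))

parityLead-cong : ∀ {i p q} → p ≋ q → ParityLead i p → ParityLead i q
parityLead-cong e (parityLead h c c>0 l) = parityLead h c c>0 (lead-cong e l)

-- The sign of `u` is immaterial modulo 2: e = 2f - u - 2h = u + 2(f - u - h).
parity-shift : ∀ e u h f → addE e (addE u (addE h h)) ≡ addE f f → Σ Exp λ s → e ≡ addE u (addE s s)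
parity-shift (a , b , c) (a₁ , b₁ , c₁) (a₂ , b₂ , c₂) (a₃ , b₃ , c₃) eq =
  (a₃ ℤ.- a₁ ℤ.- a₂ , b₃ ℤ.- b₁ ℤ.- b₂ , c₃ ℤ.- c₁ ℤ.- c₂) ,
  cong₂ _,_ (shift a a₁ a₂ a₃ (cong proj₁ eq))
       (cong₂ _,_ (shift b b₁ b₂ b₃ (cong (λ t → proj₁ (proj₂ t)) eq))
                  (shift c c₁ c₂ c₃ (cong (λ t → proj₂ (proj₂ t)) eq)))
  where
  open +-*-Solver
  shift : ∀ x u h f → x ℤ.+ (u ℤ.+ (h ℤ.+ h)) ≡ f ℤ.+ f →
    x ≡ u ℤ.+ ((f ℤ.- u ℤ.- h) ℤ.+ (f ℤ.- u ℤ.- h))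
  shift x u h f e = begin
    x                                                        ≡⟨ solve 3 (λ x u h → x := x :+ (u :+ (h :+ h)) :- (u :+ (h :+ h))) refl x u h ⟩
    x ℤ.+ (u ℤ.+ (h ℤ.+ h)) ℤ.- (u ℤ.+ (h ℤ.+ h))            ≡⟨ cong (ℤ._- (u ℤ.+ (h ℤ.+ h))) e ⟩
    f ℤ.+ f ℤ.- (u ℤ.+ (h ℤ.+ h))
      ≡⟨ solve 3 (λ u h f → f :+ f :- (u :+ (h :+ h)) := u :+ ((f :- u :- h) :+ (f :- u :- h))) refl u h f ⟩
    u ℤ.+ ((f ℤ.- u ℤ.- h) ℤ.+ (f ℤ.- u ℤ.- h))              ∎
    where open ≡-Reasoning

-- Reduced mutation sequences

record Distinct (i j l : Fin 3) : Set where
  constructor distinct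
  field
    i≢j : i ≢ j
    i≢l : i ≢ l
    j≢l : j ≢ l

others : ∀ i → Σ (Fin 3) λ j → Σ (Fin 3) λ l → Distinct i j l
others zero = suc zero , suc (suc zero) , distinct (λ ()) (λ ()) (λ ())
others (suc zero) = zero , suc (suc zero) , distinct (λ ()) (λ ()) (λ ())
others (suc (suc zero)) = zero , suc zero , distinct (λ ()) (λ ()) (λ ())

third : ∀ i j → i ≢ j → Σ (Fin 3) λ l → Distinct i j l
third i j i≢j with others i
... | j′ , l′ , distinct a b c with j′ ≟ j
...   | yes refl = l′ , distinct a b c
...   | no j′≢j = j′ , distinct i≢j a (λ e → j′≢j (sym e))

abstract
  pigeonhole : ∀ (m i j l : Fin 3) → m ≡ i ⊎ m ≡ j ⊎ m ≡ l ⊎ i ≡ j ⊎ i ≡ l ⊎ j ≡ l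
  pigeonhole = from-yes (all? {3} λ m → all? {3} λ i → all? {3} λ j → all? {3} λ l →
    (m ≟ i) ⊎-dec ((m ≟ j) ⊎-dec ((m ≟ l) ⊎-dec ((i ≟ j) ⊎-dec ((i ≟ l) ⊎-dec (j ≟ l))))))

  among : ∀ {i j l} → Distinct i j l → ∀ m → m ≢ i → m ≡ j ⊎ m ≡ l
  among {i} {j} {l} (distinct a b c) m m≢i with pigeonhole m i j l
  ... | inj₁ h = ⊥-elim (m≢i h)
  ... | inj₂ (inj₁ h) = inj₁ h
  ... | inj₂ (inj₂ (inj₁ h)) = inj₂ h
  ... | inj₂ (inj₂ (inj₂ (inj₁ h))) = ⊥-elim (a h)
  ... | inj₂ (inj₂ (inj₂ (inj₂ (inj₁ h)))) = ⊥-elim (b h)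
  ... | inj₂ (inj₂ (inj₂ (inj₂ (inj₂ h)))) = ⊥-elim (c h)

Cluster : Set
Cluster = Fin 3 → L

module Clusters (k₁ k₂ k₃ : ℕ) where

  parity : Fin 3 → L
  parity i = cN (kv k₁ k₂ k₃ i)

  -- `exchanged` covers both orders of the other two positions, so that permutations of places need
  -- no bookkeeping; `exchanged-from` obtains it from one order by symmetry.
  record Mutation (i : Fin 3) (C C′ : Cluster) : Set where
    field
      unchanged : ∀ j → j ≢ i → C′ j ≋ C j
      exchanged : ∀ {j l} → Distinct i j l → C′ i *L C i ≋ exchange (parity i) (C j) (C l)
  open Mutation

  -- A reduced sequence of mutations starting at the seed, indexed by its last direction.
  data Reduced : Maybe (Fin 3) → Cluster → Set where
    root : ∀ {C} → (∀ j → C j ≋ var j) → Reduced nothing C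
    node : ∀ {m C C′} i → Reduced m C → m ≢ just i → Mutation i C C′ → Reduced (just i) C′

  record Bounds (m : Maybe (Fin 3)) (C : Cluster) : Set where
    field
      positive : ∀ j → + 0 ℤ.< ∣ C j ∣L
      initial : m ≡ nothing → ∀ j → ∣ C j ∣L ≡ + 1
      maximal : ∀ {i} → m ≡ just i → ∀ j → j ≢ i → ∣ C j ∣L ℤ.< ∣ C i ∣L
  open Bounds

  value-var : ∀ j → ∣ var j ∣L ≡ + 1
  value-var zero = refl
  value-var (suc zero) = refl
  value-var (suc (suc zero)) = refl

  -- The position `j` plays the part of u in `exchange-growth`. At the seed all values are 1 and any
  -- other position will do; later it is the last mutated position, which differs from `i` because
  -- the sequence is reduced.
  pivot : ∀ {m C} i → m ≢ just i → Bounds m C →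
    Σ (Fin 3) λ j → Σ (Fin 3) λ l → Distinct i j l × ∣ C i ∣L ℤ.≤ ∣ C j ∣L × ∣ C l ∣L ℤ.≤ ∣ C j ∣L
  pivot {nothing} i m≢ b with others i
  ... | j , l , d = j , l , d , ℤP.≤-reflexive (trans (initial b refl i) (sym (initial b refl j))) ,
        ℤP.≤-reflexive (trans (initial b refl l) (sym (initial b refl j)))
  pivot {just j} i m≢ b with third i j (λ e → m≢ (cong just (sym e)))
  ... | l , d@(distinct i≢j _ j≢l) = j , l , d ,
    ℤP.<⇒≤ (maximal b refl i i≢j) , ℤP.<⇒≤ (maximal b refl l (λ e → j≢l (sym e)))

  -- The new value exceeds that of the pivot by `exchange-value-growth`, hence also the remaining
  -- one.
  reduced-bounds : ∀ {m C} → Reduced m C → Bounds m C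
  reduced-bounds (root h) = record
    { positive = λ j → subst (+ 0 ℤ.<_) (sym (one j)) (+<+ (ℕ.s≤s z≤n))
    ; initial = λ _ → one
    ; maximal = λ () }
    where
    one : ∀ j → _
    one j = trans (value-cong (h j)) (value-var j)
  reduced-bounds (node {m} {C} {C′} i t m≢ μ) with reduced-bounds t
  ... | b with pivot i m≢ b
  ...   | j , l , d , i≤j , l≤j = record { positive = pos ; initial = λ () ; maximal = λ { refl → less } }
    where
    grow : ∣ C j ∣L ℤ.< ∣ C′ i ∣L
    grow = exchange-value-growth (parity i) (C′ i) (C i) (C j) (C l)
      (subst (+ 0 ℤ.≤_) (sym (value-cst (+ kv k₁ k₂ k₃ i))) (+≤+ z≤n)) (exchanged μ d)
      (positive b i) (positive b j) (positive b l) i≤j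
    less : ∀ n → n ≢ i → ∣ C′ n ∣L ℤ.< ∣ C′ i ∣L
    less n n≢i with among d n n≢i
    ... | inj₁ refl = subst (ℤ._< _) (sym (value-cong (unchanged μ n n≢i))) grow
    ... | inj₂ refl = subst (ℤ._< _) (sym (value-cong (unchanged μ n n≢i))) (ℤP.≤-<-trans l≤j grow)
    pos : ∀ n → + 0 ℤ.< ∣ C′ n ∣L
    pos n with n ≟ i
    ... | yes refl = ℤP.<-trans (positive b j) grow
    ... | no n≢i = subst (+ 0 ℤ.<_) (sym (value-cong (unchanged μ n n≢i))) (positive b n)

  value-pos⇒≢0 : ∀ {p} → + 0 ℤ.< ∣ p ∣L → ¬ (p ≋ 0L)
  value-pos⇒≢0 h z = pos≢0 h (value-cong z)

  reduced-nonzero : ∀ {m C} → Reduced m C → ∀ j → ¬ (C j ≋ 0L)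
  reduced-nonzero t j = value-pos⇒≢0 (positive (reduced-bounds t) j)

  reduced-cong : ∀ {m C C′} → (∀ j → C′ j ≋ C j) → Reduced m C → Reduced m C′
  reduced-cong h (root r) = root λ j → ≋-trans (h j) (r j)
  reduced-cong {C = C} {C′} h (node {C = C₀} i t m≢ μ) = node i t m≢ record
    { unchanged = λ j j≢i → ≋-trans (h j) (unchanged μ j j≢i)
    ; exchanged = λ d → ≋-trans (*L-cong (h i) (≋-refl {C₀ i})) (exchanged μ d) }

  -- A mutation in the last direction undoes it and shortens the sequence; any other mutation
  -- extends the sequence.
  reduced-mutate : ∀ {m C C′} i → Reduced m C → Mutation i C C′ → Σ (Maybe (Fin 3)) λ m′ → Reduced m′ C′
  reduced-mutate {m} i t μ with MaybeP.≡-dec _≟_ m (just i)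
  ... | no m≢i = just i , node i t m≢i μ
  reduced-mutate {C = C} {C′} i t@(node {m} {C₀} .i t₀ _ μ₀) μ | yes refl = m , reduced-cong back t₀
    where
    back : ∀ j → C′ j ≋ C₀ j
    back j with j ≟ i
    ... | no j≢i = ≋-trans (unchanged μ j j≢i) (unchanged μ₀ j j≢i)
    ... | yes refl with others i
    -- `C′ i` and `C₀ i` have the same product with the nonzero `C i`, namely the exchange
    -- polynomial of the two entries that did not move.
    ...   | a , b , d@(distinct i≢a i≢b _) = *L-cancelˡ (reduced-nonzero t i)
      (≋-trans (*L-comm (C i) (C′ i)) (≋-trans (exchanged μ d) (≋-trans
        (exchange-cong (parity i) (unchanged μ₀ a (λ e → i≢a (sym e))) (unchanged μ₀ b (λ e → i≢b (sym e))))
        (≋-sym (exchanged μ₀ d)))))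

  exchanged-from : ∀ {i} (C : Cluster) {p} → let (j₀ , l₀ , _) = others i in
    p ≋ exchange (parity i) (C j₀) (C l₀) →
    ∀ {j l} → Distinct i j l → p ≋ exchange (parity i) (C j) (C l)
  exchanged-from {i} C h {j} {l} (distinct i≢j i≢l j≢l) with others i
  ... | j₀ , l₀ , d₀ with among d₀ j (λ e → i≢j (sym e)) | among d₀ l (λ e → i≢l (sym e))
  ...   | inj₁ refl | inj₁ refl = ⊥-elim (j≢l refl)
  ...   | inj₁ refl | inj₂ refl = h
  ...   | inj₂ refl | inj₁ refl = ≋-trans h (I.exchange-symm (C l) (C j) (parity i))
  ...   | inj₂ refl | inj₂ refl = ⊥-elim (j≢l refl)

  labelled-reduced : ∀ {a b c} → LCluster k₁ k₂ k₃ a b c → Σ (Maybe (Fin 3)) λ m → Reduced m (triple a b c)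
  labelled-reduced seed = nothing , root λ { zero → ≋-refl ; (suc zero) → ≋-refl ; (suc (suc zero)) → ≋-refl }
  labelled-reduced (μ₁ {a} {b} {c} a′ t e) = reduced-mutate zero (proj₂ (labelled-reduced t)) record
    { unchanged = λ { zero h → ⊥-elim (h refl) ; (suc zero) _ → ≋-refl ; (suc (suc zero)) _ → ≋-refl }
    ; exchanged = exchanged-from (triple a b c) (≈⇒≋ e) }
  labelled-reduced (μ₂ {a} {b} {c} b′ t e) = reduced-mutate (suc zero) (proj₂ (labelled-reduced t)) record
    { unchanged = λ { zero _ → ≋-refl ; (suc zero) h → ⊥-elim (h refl) ; (suc (suc zero)) _ → ≋-refl }
    ; exchanged = exchanged-from (triple a b c) (≈⇒≋ e) }
  labelled-reduced (μ₃ {a} {b} {c} c′ t e) = reduced-mutate (suc (suc zero)) (proj₂ (labelled-reduced t)) record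
    { unchanged = λ { zero _ → ≋-refl ; (suc zero) _ → ≋-refl ; (suc (suc zero)) h → ⊥-elim (h refl) }
    ; exchanged = exchanged-from (triple a b c) (≈⇒≋ e) }

  var-parityLead : ∀ j → ParityLead j (var j)
  var-parityLead zero = parityLead zeroE (+ 1) (+<+ (ℕ.s≤s z≤n)) (lead [] ≋-refl)
  var-parityLead (suc zero) = parityLead zeroE (+ 1) (+<+ (ℕ.s≤s z≤n)) (lead [] ≋-refl)
  var-parityLead (suc (suc zero)) = parityLead zeroE (+ 1) (+<+ (ℕ.s≤s z≤n)) (lead [] ≋-refl)

  -- The exchange polynomial has a leading exponent 2f. Dividing by the old entry, of exponent
  -- `unitE n` + 2h, leaves 2f - `unitE n` - 2h, again congruent to `unitE n` modulo 2.
  reduced-parityLead : ∀ {m C} → Reduced m C → ∀ j → ParityLead j (C j)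
  reduced-parityLead (root h) j = parityLead-cong (≋-sym (h j)) (var-parityLead j)
  reduced-parityLead (node {C = C} {C′} i t _ μ) n with n ≟ i
  ... | no n≢i = parityLead-cong (≋-sym (unchanged μ n n≢i)) (reduced-parityLead t n)
  ... | yes refl with others n
  ...   | j , l , d with reduced-parityLead t n | reduced-parityLead t j | reduced-parityLead t l
  ...     | parityLead h c c>0 lc | parityLead _ _ cj>0 lj | parityLead _ _ cl>0 ll
    with lead-exchange-pos (kv k₁ k₂ k₃ n) cj>0 cl>0 lj ll
  ...       | f , _ , b>0 , lf with lead-quotient c>0 b>0 (exchanged μ d) lc lf
  ...         | e′ , c′ , c′>0 , l′ , eq with parity-shift e′ (unitE n) h f eq
  ...           | s , refl = parityLead s c′ c′>0 l′

  occurs-parityLead : ∀ {i p} → OccursAt k₁ k₂ k₃ i p → ParityLead i p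
  occurs-parityLead {i} (a , b , c , t , e) =
    parityLead-cong (≋-sym (≈⇒≋ e)) (reduced-parityLead (proj₂ (labelled-reduced t)) i)

-- Triples of matrices

component : Triple → Fin 3 → M2
component t zero = t1 t
component t (suc zero) = t2 t
component t (suc (suc zero)) = t3 t

infix 4 _≋T_
record _≋T_ (s t : Triple) : Set where
  constructor components
  field
    ≋t1 : t1 s ≋M t1 t
    ≋t2 : t2 s ≋M t2 t
    ≋t3 : t3 s ≋M t3 t
open _≋T_

≋T-sym : ∀ {s t} → s ≋T t → t ≋T s
≋T-sym (components a b c) = components (≋M-sym a) (≋M-sym b) (≋M-sym c)

≋T-trans : ∀ {s t u} → s ≋T t → t ≋T u → s ≋T u
≋T-trans (components a b c) (components a′ b′ c′) =
  components (≋M-trans a a′) (≋M-trans b b′) (≋M-trans c c′)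

≈T⇒≋T : ∀ {s t} → s ≈T t → s ≋T t
≈T⇒≋T (a , b , c) = components (≈M⇒≋M a) (≈M⇒≋M b) (≈M⇒≋M c)

≋T⇒≈T : ∀ {s t} → s ≋T t → s ≈T t
≋T⇒≈T (components a b c) = ≋M⇒≈M a , ≋M⇒≈M b , ≋M⇒≈M c

unstep : Dir → Triple → Triple
unstep left ⟨ X , Y , Z ⟩ = ⟨ X , Z , conj⁻ Z Y ⟩
unstep right ⟨ X , Y , Z ⟩ = ⟨ conj X Y , X , Z ⟩

step-cong : ∀ d {s t} → s ≋T t → step d s ≋T step d t
step-cong left (components a b c) = components a (conj-cong b c) b
step-cong right (components a b c) = components b (conj⁻-cong b a) c

unstep-cong : ∀ d {s t} → s ≋T t → unstep d s ≋T unstep d t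
unstep-cong left (components a b c) = components a c (conj⁻-cong c b)
unstep-cong right (components a b c) = components (conj-cong a b) a c

Unimodular : Triple → Set
Unimodular t = ∀ j → det (component t j) ≋ 1L

step-unimodular : ∀ d t → Unimodular t → Unimodular (step d t)
step-unimodular left t u zero = u zero
step-unimodular left t u (suc zero) = unit-conj (t2 t) (t3 t) (u (suc zero)) (u (suc (suc zero)))
step-unimodular left t u (suc (suc zero)) = u (suc zero)
step-unimodular right t u zero = u (suc zero)
step-unimodular right t u (suc zero) = unit-conj⁻ (t2 t) (t1 t) (u (suc zero)) (u zero)
step-unimodular right t u (suc (suc zero)) = u (suc (suc zero))

unstep-unimodular : ∀ d t → Unimodular t → Unimodular (unstep d t)
unstep-unimodular left t u zero = u zero
unstep-unimodular left t u (suc zero) = u (suc (suc zero))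
unstep-unimodular left t u (suc (suc zero)) = unit-conj⁻ (t3 t) (t2 t) (u (suc (suc zero))) (u (suc zero))
unstep-unimodular right t u zero = unit-conj (t1 t) (t2 t) (u zero) (u (suc zero))
unstep-unimodular right t u (suc zero) = u zero
unstep-unimodular right t u (suc (suc zero)) = u (suc (suc zero))

step-unstep : ∀ d t → Unimodular t → step d (unstep d t) ≋T t
step-unstep left t u = components ≋M-refl (conj-conj⁻ (t3 t) (t2 t) (u (suc (suc zero)))) ≋M-refl
step-unstep right t u = components ≋M-refl (conj⁻-conj (t1 t) (t2 t) (u zero)) ≋M-refl

unstep-step : ∀ d t → Unimodular t → unstep d (step d t) ≋T t
unstep-step left t u = components ≋M-refl ≋M-refl (conj⁻-conj (t2 t) (t3 t) (u (suc zero)))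
unstep-step right t u = components (conj-conj⁻ (t2 t) (t1 t) (u (suc zero))) ≋M-refl ≋M-refl

product : Triple → M2
product t = t1 t · t2 t · t3 t

product-cong : ∀ {s t} → s ≋T t → product s ≋M product t
product-cong (components a b c) = ·-cong (·-cong a b) c

-- (YZY⁻¹)Y = YZ for a left step, Y(Y⁻¹XY) = XY for a right step.
step-product : ∀ d t → Unimodular t → product (step d t) ≋M product t
step-product left ⟨ X , Y , Z ⟩ u = ≋M-trans (·-assoc X (conj Y Z) Y)
  (≋M-trans (·-congˡ X (inv-cancelʳ′ Y (Y · Z) (u (suc zero)))) (≋M-sym (·-assoc X Y Z)))
step-product right ⟨ X , Y , Z ⟩ u = ·-congʳ Z (·-conj⁻ Y X (u (suc zero)))

unstep-product : ∀ d t → Unimodular t → product (unstep d t) ≋M product t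
unstep-product d t u =
  ≋M-trans (≋M-sym (step-product d (unstep d t) (unstep-unimodular d t u))) (product-cong (step-unstep d t u))

-- `walk` read from the end: the head of the list is the last move.
climb : List Dir → Triple → Triple
climb [] t = t
climb (d ∷ p) t = step d (climb p t)

climb-∷ʳ : ∀ p d t → climb (p ∷ʳ d) t ≡ climb p (step d t)
climb-∷ʳ [] d t = refl
climb-∷ʳ (d′ ∷ p) d t = cong (step d′) (climb-∷ʳ p d t)

walk-climb : ∀ p t → walk p t ≡ climb (reverse p) t
walk-climb [] t = refl
walk-climb (d ∷ p) t = trans (walk-climb p (step d t))
  (trans (sym (climb-∷ʳ (reverse p) d t)) (cong (λ q → climb q t) (sym (unfold-reverse d p))))

climb-unimodular : ∀ p t → Unimodular t → Unimodular (climb p t)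
climb-unimodular [] t u = u
climb-unimodular (d ∷ p) t u = step-unimodular d (climb p t) (climb-unimodular p t u)

climb-product : ∀ p t → Unimodular t → product (climb p t) ≋M product t
climb-product [] t u = ≋M-refl
climb-product (d ∷ p) t u =
  ≋M-trans (step-product d (climb p t) (climb-unimodular p t u)) (climb-product p t u)

neg-exchange : ∀ κ u v → u *L u +L v *L v -L u *L v *L (-L κ) ≋ exchange κ u v
neg-exchange κ u v = I.exchange-form u v κ

-- The product of the two matrices involved has the (1,2)-entry of the third one, so s in the
-- conjugation identity is itself an entry of the triple. The next three lemmas treat the right step
-- and the two inverse steps in the same way.
left-exchange : ∀ {k₁ k₂ k₃} t κ → Unimodular t → product t ≋M T k₁ k₂ k₃ → tr (t3 t) ≋ -L κ →
  m12 (conj (t2 t) (t3 t)) *L m12 (t3 t) ≋ exchange κ (m12 (t2 t)) (m12 (t1 t))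
left-exchange {k₁} {k₂} {k₃} ⟨ X , Y , Z ⟩ κ u e h = ≋-trans
  (conj-exchange Y Z (u (suc (suc zero))) (·-12-right {k₁} {k₂} {k₃} X Y Z (u zero) e) h) (neg-exchange κ (m12 Y) (m12 X))

right-exchange : ∀ {k₁ k₂ k₃} t κ → Unimodular t → product t ≋M T k₁ k₂ k₃ → tr (t1 t) ≋ -L κ →
  m12 (conj⁻ (t2 t) (t1 t)) *L m12 (t1 t) ≋ exchange κ (m12 (t2 t)) (m12 (t3 t))
right-exchange {k₁} {k₂} {k₃} ⟨ X , Y , Z ⟩ κ u e h = ≋-trans
  (conj⁻-exchange X Y (u zero) (·-12-left {k₁} {k₂} {k₃} X Y Z (u (suc (suc zero))) e) h) (neg-exchange κ (m12 Y) (m12 Z))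

unleft-exchange : ∀ {k₁ k₂ k₃} t κ → Unimodular t → product t ≋M T k₁ k₂ k₃ → tr (t2 t) ≋ -L κ →
  m12 (conj⁻ (t3 t) (t2 t)) *L m12 (t2 t) ≋ exchange κ (m12 (t3 t)) (m12 (t1 t))
unleft-exchange {k₁} {k₂} {k₃} ⟨ X , Y , Z ⟩ κ u e h = ≋-trans
  (conj⁻-exchange Y Z (u (suc zero)) (·-12-right {k₁} {k₂} {k₃} X Y Z (u zero) e) h) (neg-exchange κ (m12 Z) (m12 X))

unright-exchange : ∀ {k₁ k₂ k₃} t κ → Unimodular t → product t ≋M T k₁ k₂ k₃ → tr (t2 t) ≋ -L κ →
  m12 (conj (t1 t) (t2 t)) *L m12 (t2 t) ≋ exchange κ (m12 (t1 t)) (m12 (t3 t))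
unright-exchange {k₁} {k₂} {k₃} ⟨ X , Y , Z ⟩ κ u e h = ≋-trans
  (conj-exchange X Y (u (suc zero)) (·-12-left {k₁} {k₂} {k₃} X Y Z (u (suc (suc zero))) e) h) (neg-exchange κ (m12 X) (m12 Z))

-- Compared with `IsVertex`, the path is read from its end, and the root is written as `step left`
-- of the base matrices, so that it is handled like an edge.
Vertex : ℕ → ℕ → ℕ → Permutation′ 3 → L → List Dir → Triple → Set
Vertex k₁ k₂ k₃ σ f p t =
  Σ M2 λ X → Σ M2 λ Y → Σ M2 λ Z →
    IsXσ k₁ k₂ k₃ (τ σ) f X × IsYσ k₁ k₂ k₃ (τ σ) f Y × IsZσ k₁ k₂ k₃ (τ σ) f Z ×
    (climb p (step left ⟨ X , Y , Z ⟩) ≋T t)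

vertex⇒isVertex : ∀ {k₁ k₂ k₃ σ f p t} → Vertex k₁ k₂ k₃ σ f p t → IsVertex k₁ k₂ k₃ σ f (reverse p) t
vertex⇒isVertex {p = p} {t} (X , Y , Z , isX , isY , isZ , e) = X , Y , Z , isX , isY , isZ ,
  ≋T⇒≈T (subst (_≋T t) (sym (trans (walk-climb (reverse p) _)
    (cong (λ q → climb q (step left ⟨ X , Y , Z ⟩)) (reverse-involutive p)))) e)

isVertex⇒vertex : ∀ {k₁ k₂ k₃ σ f p t} → IsVertex k₁ k₂ k₃ σ f p t → Vertex k₁ k₂ k₃ σ f (reverse p) t
isVertex⇒vertex {p = p} {t} (X , Y , Z , isX , isY , isZ , e) = X , Y , Z , isX , isY , isZ ,
  subst (_≋T t) (walk-climb p (step left ⟨ X , Y , Z ⟩)) (≈T⇒≋T e)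

permutation-injective : ∀ (π : Permutation′ 3) {i j} → π ⟨$⟩ʳ i ≡ π ⟨$⟩ʳ j → i ≡ j
permutation-injective π e = trans (sym (inverseˡ π)) (trans (cong (π ⟨$⟩ˡ_) e) (inverseˡ π))

permutation-distinct : ∀ (π : Permutation′ 3) {i j l} → Distinct i j l →
  Distinct (π ⟨$⟩ʳ i) (π ⟨$⟩ʳ j) (π ⟨$⟩ʳ l)
permutation-distinct π (distinct a b c) = distinct
  (λ e → a (permutation-injective π e)) (λ e → b (permutation-injective π e)) (λ e → c (permutation-injective π e))

middle-distinct : Distinct (suc zero) zero (suc (suc zero))
middle-distinct = distinct (λ ()) (λ ()) (λ ())

-- The effect of `unstep` on places: the mutated middle matrix goes to third (left) or first (right)
-- place, and the matrix from there becomes the middle one.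
swap : Dir → Permutation′ 3
swap left = transpose (suc zero) (suc (suc zero))
swap right = transpose zero (suc zero)

-- Existence of a vertex

module Existence (k₁ k₂ k₃ : ℕ) where
  open Clusters k₁ k₂ k₃
  open Mutation

  -- `π` sends the place of a matrix to the position of its (1,2)-entry in the labeled cluster; that
  -- position prescribes the trace.
  record Matches (C : Cluster) (π : Permutation′ 3) (t : Triple) : Set where
    field
      unimodular : Unimodular t
      product-T : product t ≋M T k₁ k₂ k₃
      entry : ∀ j → m12 (component t j) ≋ C (π ⟨$⟩ʳ j)
      trace : ∀ j → tr (component t j) ≋ -L parity (π ⟨$⟩ʳ j)
  open Matches

  -- Both inverse steps undo the same mutation, that of the middle entry, and differ only in where
  -- the result is placed; hence `d` is arbitrary.
  unstep-matches : ∀ d {C⁻ C} (π : Permutation′ 3) {t} → Mutation (π ⟨$⟩ʳ suc zero) C⁻ C → ¬ (C (π ⟨$⟩ʳ suc zero) ≋ 0L) →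
    Matches C π t → Matches C⁻ (swap d ∘ₚ π) (unstep d t)
  unstep-matches d {C⁻} {C} π {t} μ nz M = record
    { unimodular = unstep-unimodular d t u
    ; product-T = ≋M-trans (unstep-product d t u) (product-T M)
    ; entry = entries′ d
    ; trace = traces′ d }
    where
    u = unimodular M
    mid = π ⟨$⟩ʳ suc zero
    kₘ = parity mid
    kept : ∀ j → j ≢ suc zero → m12 (component t j) ≋ C⁻ (π ⟨$⟩ʳ j)
    kept j j≢1 = ≋-trans (entry M j) (unchanged μ (π ⟨$⟩ʳ j) (λ e → j≢1 (permutation-injective π e)))
    -- `p` and the earlier cluster entry have the same product with the nonzero current middle
    -- entry.
    mutated : ∀ {p} q r → m12 (component t (suc zero)) ≋ C mid → p *L m12 (t2 t) ≋ exchange kₘ q r →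
      exchange kₘ q r ≋ C mid *L C⁻ mid → p ≋ C⁻ mid
    mutated {p} q r h e e′ = *L-cancelˡ nz
      (≋-trans (*L-comm (C mid) p) (≋-trans (*L-cong (≋-refl {p}) (≋-sym h)) (≋-trans e e′)))
    entries′ : ∀ d j → m12 (component (unstep d t) j) ≋ C⁻ ((swap d ∘ₚ π) ⟨$⟩ʳ j)
    entries′ left zero = kept zero (λ ())
    entries′ left (suc zero) = kept (suc (suc zero)) (λ ())
    entries′ left (suc (suc zero)) = mutated (m12 (t3 t)) (m12 (t1 t)) (entry M (suc zero))
      (unleft-exchange {k₁} {k₂} {k₃} t kₘ u (product-T M) (trace M (suc zero)))
      (≋-trans (exchange-cong kₘ (kept (suc (suc zero)) (λ ())) (kept zero (λ ())))
        (≋-sym (exchanged μ (permutation-distinct π (distinct (λ ()) (λ ()) (λ ()))))))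
    entries′ right zero = mutated (m12 (t1 t)) (m12 (t3 t)) (entry M (suc zero))
      (unright-exchange {k₁} {k₂} {k₃} t kₘ u (product-T M) (trace M (suc zero)))
      (≋-trans (exchange-cong kₘ (kept zero (λ ())) (kept (suc (suc zero)) (λ ())))
        (≋-sym (exchanged μ (permutation-distinct π (distinct (λ ()) (λ ()) (λ ()))))))
    entries′ right (suc zero) = kept zero (λ ())
    entries′ right (suc (suc zero)) = kept (suc (suc zero)) (λ ())
    traces′ : ∀ d j → tr (component (unstep d t) j) ≋ -L parity ((swap d ∘ₚ π) ⟨$⟩ʳ j)
    traces′ left zero = trace M zero
    traces′ left (suc zero) = trace M (suc (suc zero))
    traces′ left (suc (suc zero)) = ≋-trans (tr-conj⁻ (t3 t) (t2 t) (u (suc (suc zero)))) (trace M (suc zero))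
    traces′ right zero = ≋-trans (tr-conj (t1 t) (t2 t) (u zero)) (trace M (suc zero))
    traces′ right (suc zero) = trace M zero
    traces′ right (suc (suc zero)) = trace M (suc (suc zero))

  -- Over the seed the (1,2)-entries are variables. Then (XY)₁₂ = z₁₂ and (YZ)₁₂ = x₁₂ fix the lower
  -- diagonal entries of Y and Z, and the traces fix the upper ones; `f` is x₁₁, which a left
  -- inverse step leaves alone.
  root-vertex : ∀ {C} π t → Unimodular t → (∀ j → C j ≋ var j) → Matches C (swap left ∘ₚ π) (unstep left t) →
    Vertex k₁ k₂ k₃ π (m11 (t1 t)) [] t
  root-vertex {C} π t u r M = X , Y , Z ,
    (≋⇒≈ (≋-refl {f}) , ≋⇒≈ eX , ≋⇒≈ (I.X-22 f (m22 X) (parity (π ⟨$⟩ʳ zero)) (trace M zero)) , ≋⇒≈ (unimodular M zero)) ,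
    (≋⇒≈ y11 , ≋⇒≈ eY , ≋⇒≈ y22 , ≋⇒≈ (unimodular M (suc zero))) ,
    (≋⇒≈ (I.Z-11 f y₁ y₂ y₃ (m11 Z) (m22 Z) κ₂ κ₃ z22 (trace M (suc (suc zero)))) , ≋⇒≈ eZ , ≋⇒≈ z22 ,
      ≋⇒≈ (unimodular M (suc (suc zero)))) ,
    step-unstep left t u
    where
    X = t1 (unstep left t)
    Y = t2 (unstep left t)
    Z = t3 (unstep left t)
    f = m11 X
    y₁ = var (π ⟨$⟩ʳ zero)
    -- The last two places are interchanged because the base matrices are indexed by `τ π`.
    y₂ = var (π ⟨$⟩ʳ suc (suc zero))
    y₃ = var (π ⟨$⟩ʳ suc zero)
    κ₂ = parity (π ⟨$⟩ʳ suc (suc zero))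
    κ₃ = parity (π ⟨$⟩ʳ suc zero)
    eX : m12 X ≋ y₁
    eX = ≋-trans (entry M zero) (r _)
    eY : m12 Y ≋ y₂
    eY = ≋-trans (entry M (suc zero)) (r _)
    eZ : m12 Z ≋ y₃
    eZ = ≋-trans (entry M (suc (suc zero))) (r _)
    y22 = I.Y-22 f y₁ y₂ y₃ (m22 Y) (≋-trans
      (+L-cong (*L-cong (≋-refl {f}) (≋-sym eY)) (*L-cong (≋-sym eX) (≋-refl {m22 Y})))
      (≋-trans (·-12-left {k₁} {k₂} {k₃} X Y Z (unimodular M (suc (suc zero))) (product-T M)) eZ))
    y11 = I.Y-11 f y₁ y₂ y₃ (m11 Y) (m22 Y) κ₂ y22 (trace M (suc zero))
    z22 = I.Z-22 f y₁ y₂ y₃ (m11 Y) (m22 Z) κ₂ y11 (≋-trans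
      (+L-cong (*L-cong (≋-refl {m11 Y}) (≋-sym eZ)) (*L-cong (≋-sym eY) (≋-refl {m22 Z})))
      (≋-trans (·-12-right {k₁} {k₂} {k₃} X Y Z (unimodular M zero) (product-T M)) eX))

  SomeVertex : Triple → Set
  SomeVertex t = Σ L λ f → Σ (Permutation′ 3) λ σ → Σ (List Dir) λ p → Vertex k₁ k₂ k₃ σ f p t

  child : ∀ d {t} → Unimodular t → SomeVertex (unstep d t) → SomeVertex t
  child d {t} u (f , σ , p , X , Y , Z , isX , isY , isZ , e) =
    f , σ , d ∷ p , X , Y , Z , isX , isY , isZ , ≋T-trans (step-cong d e) (step-unstep d t u)

  -- Induction along the reduced sequence, with the last mutated position kept in the middle. The
  -- direction `j` before it differs from the middle, so it sits in first or third place, and the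
  -- right or left inverse step, respectively, brings it to the middle.
  vertex-exists : ∀ {C i} (π : Permutation′ 3) t → Reduced (just i) C → i ≡ π ⟨$⟩ʳ suc zero → Matches C π t →
    SomeVertex t
  -- Either inverse step would reach the seed here; the left one is taken because the root arises
  -- from the base matrices by a left step.
  vertex-exists π t R@(node _ (root r) _ μ) refl M =
    m11 (t1 t) , π , [] , root-vertex π t (unimodular M) r (unstep-matches left π μ (reduced-nonzero R _) M)
  vertex-exists π t R@(node _ R₀@(node j _ _ _) j≢ μ) refl M =
    [ (λ j≡ → child right (unimodular M) (vertex-exists (swap right ∘ₚ π) (unstep right t) R₀ j≡
        (unstep-matches right π μ (reduced-nonzero R _) M)))
    , (λ j≡ → child left (unimodular M) (vertex-exists (swap left ∘ₚ π) (unstep left t) R₀ j≡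
        (unstep-matches left π μ (reduced-nonzero R _) M)))
    ]′ (among (permutation-distinct π middle-distinct) j (λ e → j≢ (cong just e)))

  -- The seed has equal values and so no strict maximum; a last direction other than the middle
  -- would hold a value above the middle one.
  maximal-position : ∀ {m C} (π : Permutation′ 3) → Reduced m C → ∣ C (π ⟨$⟩ʳ zero) ∣L ℤ.< ∣ C (π ⟨$⟩ʳ suc zero) ∣L →
    ∣ C (π ⟨$⟩ʳ suc (suc zero)) ∣L ℤ.< ∣ C (π ⟨$⟩ʳ suc zero) ∣L → m ≡ just (π ⟨$⟩ʳ suc zero)
  maximal-position {nothing} π R a c =
    ⊥-elim (ℤP.<-irrefl (trans (initial refl _) (sym (initial refl _))) a)
    where open Bounds (reduced-bounds R)
  maximal-position {just i} π R a c with i ≟ (π ⟨$⟩ʳ suc zero)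
  ... | yes refl = refl
  ... | no i≢ with among (permutation-distinct π middle-distinct) i i≢
  ...   | inj₁ refl = ⊥-elim (ℤP.<-asym a (Bounds.maximal (reduced-bounds R) refl _ (λ e → i≢ (sym e))))
  ...   | inj₂ refl = ⊥-elim (ℤP.<-asym c (Bounds.maximal (reduced-bounds R) refl _ (λ e → i≢ (sym e))))

  -- A CMM matrix comes with some position `j` where its entry occurs; the parity of the leading
  -- exponent forces it to be `i`.
  cmm-trace : ∀ {m C i} A → Reduced m C → CMMMatrix k₁ k₂ k₃ A → m12 A ≋ C i → tr A ≋ -L parity i
  cmm-trace {i = i} A R (_ , j , occ , h) e
    with parityLead-unique {j} {i} e (occurs-parityLead occ) (reduced-parityLead R i)
  ... | refl = ≈⇒≋ h

  cmm-vertex : ∀ X Y Z → CMMTriple k₁ k₂ k₃ ⟨ X , Y , Z ⟩ → ∣ m12 X ∣L ℤ.⊔ ∣ m12 Z ∣L ℤ.< ∣ m12 Y ∣L →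
    SomeVertex ⟨ X , Y , Z ⟩
  cmm-vertex X Y Z (cX , cY , cZ , XYZ , π , a , b , c , lc , eX , eY , eZ) max
    with labelled-reduced lc
  ... | m , R = vertex-exists π ⟨ X , Y , Z ⟩ (subst (λ n → Reduced n (triple a b c)) m≡ R) refl record
    { unimodular = λ { zero → ≈⇒≋ {det X} {1L} (proj₁ cX) ; (suc zero) → ≈⇒≋ {det Y} {1L} (proj₁ cY)
                     ; (suc (suc zero)) → ≈⇒≋ {det Z} {1L} (proj₁ cZ) }
    ; product-T = ≈M⇒≋M {X · Y · Z} {T k₁ k₂ k₃} XYZ
    ; entry = λ { zero → eX′ ; (suc zero) → eY′ ; (suc (suc zero)) → eZ′ }
    ; trace = λ { zero → cmm-trace X R cX eX′ ; (suc zero) → cmm-trace Y R cY eY′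
                ; (suc (suc zero)) → cmm-trace Z R cZ eZ′ } }
    where
    eX′ : m12 X ≋ triple a b c (π ⟨$⟩ʳ zero)
    eX′ = ≈⇒≋ eX
    eY′ : m12 Y ≋ triple a b c (π ⟨$⟩ʳ suc zero)
    eY′ = ≈⇒≋ eY
    eZ′ : m12 Z ≋ triple a b c (π ⟨$⟩ʳ suc (suc zero))
    eZ′ = ≈⇒≋ eZ
    m≡ : m ≡ just (π ⟨$⟩ʳ suc zero)
    m≡ = maximal-position π R
      (subst₂ ℤ._<_ (value-cong eX′) (value-cong eY′) (ℤP.≤-<-trans (ℤP.i≤i⊔j ∣ m12 X ∣L ∣ m12 Z ∣L) max))
      (subst₂ ℤ._<_ (value-cong eZ′) (value-cong eY′) (ℤP.≤-<-trans (ℤP.i≤j⊔i ∣ m12 X ∣L ∣ m12 Z ∣L) max))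

-- Uniqueness of the vertex

entryValue : Triple → Fin 3 → ℤ
entryValue t j = ∣ m12 (component t j) ∣L

entryValue-cong : ∀ {s t} → s ≋T t → ∀ j → entryValue s j ≡ entryValue t j
entryValue-cong (components a b c) zero = value-cong (≋12 a)
entryValue-cong (components a b c) (suc zero) = value-cong (≋12 b)
entryValue-cong (components a b c) (suc (suc zero)) = value-cong (≋12 c)

module Uniqueness (k₁ k₂ k₃ : ℕ) where
  open Clusters k₁ k₂ k₃ using (parity; value-var; value-pos⇒≢0)

  -- An invariant of all descendants of the base. The inequalities are weak so that the base, with
  -- all values 1, satisfies it, and growth needs only the signs of the traces.
  record Good (t : Triple) : Set where
    field
      unimodular : Unimodular t
      product-T : product t ≋M T k₁ k₂ k₃
      trace≤0 : ∀ j → ∣ tr (component t j) ∣L ℤ.≤ + 0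
      positive : ∀ j → + 0 ℤ.< entryValue t j
      dominated₁ : entryValue t zero ℤ.≤ entryValue t (suc zero)
      dominated₃ : entryValue t (suc (suc zero)) ℤ.≤ entryValue t (suc zero)
  open Good

  neg-trace≥0 : ∀ {t} → Good t → ∀ j → + 0 ℤ.≤ ∣ -L tr (component t j) ∣L
  neg-trace≥0 {t} g j = subst (+ 0 ℤ.≤_) (sym (value-neg (tr (component t j)))) (ℤP.neg-mono-≤ (trace≤0 g j))

  -- The exchange coefficient is minus the trace of the conjugated matrix, whose value is
  -- nonnegative.
  step-growth : ∀ d t → Good t → entryValue t (suc zero) ℤ.< entryValue (step d t) (suc zero)
  step-growth left t g = exchange-value-growth
    (-L tr (t3 t)) (m12 (t2 (step left t))) (m12 (t3 t)) (m12 (t2 t)) (m12 (t1 t))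
    (neg-trace≥0 g (suc (suc zero)))
    (left-exchange {k₁} {k₂} {k₃} t (-L tr (t3 t)) (unimodular g) (product-T g) (I.neg-neg (tr (t3 t))))
    (positive g (suc (suc zero))) (positive g (suc zero)) (positive g zero) (dominated₃ g)
  step-growth right t g = exchange-value-growth
    (-L tr (t1 t)) (m12 (t2 (step right t))) (m12 (t1 t)) (m12 (t2 t)) (m12 (t3 t))
    (neg-trace≥0 g zero)
    (right-exchange {k₁} {k₂} {k₃} t (-L tr (t1 t)) (unimodular g) (product-T g) (I.neg-neg (tr (t1 t))))
    (positive g zero) (positive g (suc zero)) (positive g (suc (suc zero))) (dominated₁ g)

  step-good : ∀ d t → Good t → Good (step d t)
  step-good d t g = record
    { unimodular = step-unimodular d t (unimodular g)
    ; product-T = ≋M-trans (step-product d t (unimodular g)) (product-T g)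
    ; trace≤0 = traces d
    ; positive = positives d
    ; dominated₁ = first d
    ; dominated₃ = last d }
    where
    traces : ∀ d j → ∣ tr (component (step d t) j) ∣L ℤ.≤ + 0
    traces left zero = trace≤0 g zero
    traces left (suc zero) = subst (ℤ._≤ + 0)
      (sym (value-cong (tr-conj (t2 t) (t3 t) (unimodular g (suc zero))))) (trace≤0 g (suc (suc zero)))
    traces left (suc (suc zero)) = trace≤0 g (suc zero)
    traces right zero = trace≤0 g (suc zero)
    traces right (suc zero) = subst (ℤ._≤ + 0)
      (sym (value-cong (tr-conj⁻ (t2 t) (t1 t) (unimodular g (suc zero))))) (trace≤0 g zero)
    traces right (suc (suc zero)) = trace≤0 g (suc (suc zero))
    middle : ∀ d → + 0 ℤ.< entryValue (step d t) (suc zero)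
    middle d = ℤP.<-trans (positive g (suc zero)) (step-growth d t g)
    positives : ∀ d j → + 0 ℤ.< entryValue (step d t) j
    positives left zero = positive g zero
    positives left (suc zero) = middle left
    positives left (suc (suc zero)) = positive g (suc zero)
    positives right zero = positive g (suc zero)
    positives right (suc zero) = middle right
    positives right (suc (suc zero)) = positive g (suc (suc zero))
    first : ∀ d → entryValue (step d t) zero ℤ.≤ entryValue (step d t) (suc zero)
    first left = ℤP.<⇒≤ (ℤP.≤-<-trans (dominated₁ g) (step-growth left t g))
    first right = ℤP.<⇒≤ (step-growth right t g)
    last : ∀ d → entryValue (step d t) (suc (suc zero)) ℤ.≤ entryValue (step d t) (suc zero)
    last left = ℤP.<⇒≤ (step-growth left t g)
    last right = ℤP.<⇒≤ (ℤP.≤-<-trans (dominated₃ g) (step-growth right t g))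

  Strict : Triple → Set
  Strict t = entryValue t zero ℤ.< entryValue t (suc zero) × entryValue t (suc (suc zero)) ℤ.< entryValue t (suc zero)

  step-strict : ∀ d t → Good t → Strict (step d t)
  step-strict left t g = ℤP.≤-<-trans (dominated₁ g) (step-growth left t g) , step-growth left t g
  step-strict right t g = step-growth right t g , ℤP.≤-<-trans (dominated₃ g) (step-growth right t g)

  record IsRoot (r : Triple) : Set where
    field
      good : Good r
      strict : Strict r
      balanced : entryValue r zero ≡ entryValue r (suc (suc zero))
  open IsRoot

  climb-good : ∀ p {r} → IsRoot r → Good (climb p r) × Strict (climb p r)
  climb-good [] R = good R , strict R
  climb-good (d ∷ p) {r} R with climb-good p R
  ... | g , _ = step-good d (climb p r) g , step-strict d (climb p r) g

  -- A step keeps one outer matrix and moves the former middle one, with the larger value, to the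
  -- other end; comparing the two ends thus reveals the step.
  Ordered : Dir → Triple → Set
  Ordered left t = entryValue t zero ℤ.< entryValue t (suc (suc zero))
  Ordered right t = entryValue t (suc (suc zero)) ℤ.< entryValue t zero

  step-ordered : ∀ d {t} → Strict t → Ordered d (step d t)
  step-ordered left (a , c) = a
  step-ordered right (a , c) = c

  ordered-unbalanced : ∀ d {t} → Ordered d t → entryValue t zero ≢ entryValue t (suc (suc zero))
  ordered-unbalanced left h e = ℤP.<-irrefl e h
  ordered-unbalanced right h e = ℤP.<-irrefl (sym e) h

  ordered-cong : ∀ d {s t} → s ≋T t → Ordered d s → Ordered d t
  ordered-cong left e = subst₂ ℤ._<_ (entryValue-cong e zero) (entryValue-cong e (suc (suc zero)))
  ordered-cong right e = subst₂ ℤ._<_ (entryValue-cong e (suc (suc zero))) (entryValue-cong e zero)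

  ordered-unique : ∀ d d′ {t} → Ordered d t → Ordered d′ t → d ≡ d′
  ordered-unique left left _ _ = refl
  ordered-unique left right h h′ = ⊥-elim (ℤP.<-asym h h′)
  ordered-unique right left h h′ = ⊥-elim (ℤP.<-asym h h′)
  ordered-unique right right _ _ = refl

  balanced-≢-step : ∀ d p {r r′} → IsRoot r → IsRoot r′ → ¬ (r ≋T climb (d ∷ p) r′)
  balanced-≢-step d p R R′ e = ordered-unbalanced d
    (ordered-cong d (≋T-sym e) (step-ordered d (proj₂ (climb-good p R′)))) (balanced R)

  -- Equal triples have the same last step, which `unstep` then removes from both. If only one path
  -- is empty, its balanced root would be the result of a step, whose ends have different values.
  climb-injective : ∀ p p′ {r r′} → IsRoot r → IsRoot r′ → climb p r ≋T climb p′ r′ → p ≡ p′ × r ≋T r′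
  climb-injective [] [] R R′ e = refl , e
  climb-injective [] (d ∷ p′) R R′ e = ⊥-elim (balanced-≢-step d p′ R R′ e)
  climb-injective (d ∷ p) [] R R′ e = ⊥-elim (balanced-≢-step d p R′ R (≋T-sym e))
  climb-injective (d ∷ p) (d′ ∷ p′) {r} {r′} R R′ e
    with climb-good p R | climb-good p′ R′
  ... | g , s | g′ , s′ with ordered-unique d d′ (ordered-cong d e (step-ordered d s)) (step-ordered d′ s′)
  ...   | refl with climb-injective p p′ R R′
               (≋T-trans (≋T-sym (unstep-step d (climb p r) (unimodular g)))
                 (≋T-trans (unstep-cong d e) (unstep-step d (climb p′ r′) (unimodular g′))))
  ...     | refl , h = refl , h

  var-injective : ∀ i j → var i ≋ var j → i ≡ j
  var-injective i j e = parityLead-unique e (var-parityLead i) (var-parityLead j)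
    where open Clusters k₁ k₂ k₃ using (var-parityLead)

  var≢0 : ∀ j → ¬ (var j ≋ 0L)
  var≢0 j = value-pos⇒≢0 (subst (+ 0 ℤ.<_) (sym (value-var j)) (+<+ (ℕ.s≤s z≤n)))

  module Base {ρ : Fin 3 → Fin 3} {f X Y Z} (isX : IsXσ k₁ k₂ k₃ ρ f X) (isY : IsYσ k₁ k₂ k₃ ρ f Y)
              (isZ : IsZσ k₁ k₂ k₃ ρ f Z) where

    base : Triple
    base = ⟨ X , Y , Z ⟩

    y₁ = var (ρ zero)
    y₂ = var (ρ (suc zero))
    y₃ = var (ρ (suc (suc zero)))

    base-entry : ∀ j → m12 (component base j) ≋ var (ρ j)
    base-entry zero = ≈⇒≋ (proj₁ (proj₂ isX))
    base-entry (suc zero) = ≈⇒≋ (proj₁ (proj₂ isY))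
    base-entry (suc (suc zero)) = ≈⇒≋ (proj₁ (proj₂ isZ))

    base-unimodular : Unimodular base
    base-unimodular zero = ≈⇒≋ {det X} {1L} (proj₂ (proj₂ (proj₂ isX)))
    base-unimodular (suc zero) = ≈⇒≋ {det Y} {1L} (proj₂ (proj₂ (proj₂ isY)))
    base-unimodular (suc (suc zero)) = ≈⇒≋ {det Z} {1L} (proj₂ (proj₂ (proj₂ isZ)))

    base-trace : ∀ j → tr (component base j) ≋ -L parity (ρ j)
    base-trace zero = ≋-trans
      (+L-cong {m11 X} {f} {m22 X} { -L f -L parity (ρ zero)} (≈⇒≋ (proj₁ isX)) (≈⇒≋ (proj₁ (proj₂ (proj₂ isX)))))
      (I.X-trace f (parity (ρ zero)))
    base-trace (suc zero) = *L-cancelˡ (var≢0 (ρ zero))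
      (I.Y-trace f y₁ y₂ y₃ (m11 Y) (m22 Y) (parity (ρ (suc zero)))
        (≈⇒≋ (proj₁ isY)) (≈⇒≋ (proj₁ (proj₂ (proj₂ isY)))))
    base-trace (suc (suc zero)) = *L-cancelˡ
      (λ z → var≢0 (ρ (suc zero)) (*L-zero-divisor (var≢0 (ρ zero)) z))
      (I.Z-trace f y₁ y₂ y₃ (m11 Z) (m22 Z) (parity (ρ (suc zero))) (parity (ρ (suc (suc zero))))
        (≈⇒≋ (proj₁ isZ)) (≈⇒≋ (proj₁ (proj₂ (proj₂ isZ)))))

    base-value : ∀ j → entryValue base j ≡ + 1
    base-value j = trans (value-cong (base-entry j)) (value-var (ρ j))

    base-good : product base ≋M T k₁ k₂ k₃ → Good base
    base-good e = record
      { unimodular = base-unimodular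
      ; product-T = e
      ; trace≤0 = λ j → subst (ℤ._≤ + 0) (sym (trans (value-cong (base-trace j)) (trans (value-neg (parity (ρ j)))
          (cong ℤ.-_ (value-cst (+ kv k₁ k₂ k₃ (ρ j))))))) ℤP.neg-≤-pos
      ; positive = λ j → subst (+ 0 ℤ.<_) (sym (base-value j)) (+<+ (ℕ.s≤s z≤n))
      ; dominated₁ = ℤP.≤-reflexive (trans (base-value zero) (sym (base-value (suc zero))))
      ; dominated₃ = ℤP.≤-reflexive (trans (base-value (suc (suc zero))) (sym (base-value (suc zero)))) }

    base-root : product base ≋M T k₁ k₂ k₃ → IsRoot (step left base)
    base-root e = record
      { good = step-good left base (base-good e)
      ; strict = step-strict left base (base-good e)
      -- The outer matrices of the root are the first two base matrices, whose entries are
      -- variables.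
      ; balanced = trans (base-value zero) (sym (base-value (suc zero))) }

    -- Steps preserve the product, so the base inherits T from the given triple; no computation with
    -- the entry formulas is made.
    vertex-product : ∀ p {t} → climb p (step left base) ≋T t → product base ≋M product t
    vertex-product p e = ≋M-trans (≋M-sym (step-product left base base-unimodular))
      (≋M-trans (≋M-sym (climb-product p (step left base) (step-unimodular left base base-unimodular))) (product-cong e))

  -- Once paths and roots agree, undoing the left step at the root identifies the bases. There `f`
  -- is the (1,1)-entry of the first matrix, and `τ σ` is read off from the variables in the
  -- (1,2)-entries.
  vertex-unique : ∀ {σ σ′ f f′ p p′ t} → product t ≋M T k₁ k₂ k₃ →
    Vertex k₁ k₂ k₃ σ f p t → Vertex k₁ k₂ k₃ σ′ f′ p′ t →
    f ≋ f′ × (∀ i → σ ⟨$⟩ʳ i ≡ σ′ ⟨$⟩ʳ i) × p ≡ p′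
  vertex-unique {σ} {σ′} {f} {f′} {p} {p′} {t} eT (X , Y , Z , isX , isY , isZ , e) (X′ , Y′ , Z′ , isX′ , isY′ , isZ′ , e′) =
    ≋-trans (≋-sym f≋) (≋-trans (≋11 (≋t1 bases)) f′≋) , perms , proj₁ inj
    where
    module B = Base {τ σ} {f} {X} {Y} {Z} isX isY isZ
    module B′ = Base {τ σ′} {f′} {X′} {Y′} {Z′} isX′ isY′ isZ′
    inj : p ≡ p′ × step left B.base ≋T step left B′.base
    inj = climb-injective p p′
      (B.base-root (≋M-trans (B.vertex-product p e) eT)) (B′.base-root (≋M-trans (B′.vertex-product p′ e′) eT))
      (≋T-trans e (≋T-sym e′))
    bases : B.base ≋T B′.base
    bases = ≋T-trans (≋T-sym (unstep-step left B.base B.base-unimodular))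
      (≋T-trans (unstep-cong left (proj₂ inj)) (unstep-step left B′.base B′.base-unimodular))
    f≋ : m11 X ≋ f
    f≋ = ≈⇒≋ (proj₁ isX)
    f′≋ : m11 X′ ≋ f′
    f′≋ = ≈⇒≋ (proj₁ isX′)
    same-entry : ∀ j → m12 (component B.base j) ≋ m12 (component B′.base j)
    same-entry zero = ≋12 (≋t1 bases)
    same-entry (suc zero) = ≋12 (≋t2 bases)
    same-entry (suc (suc zero)) = ≋12 (≋t3 bases)
    same : ∀ j → τ σ j ≡ τ σ′ j
    same j = var-injective _ _ (≋-trans (≋-sym (B.base-entry j)) (≋-trans (same-entry j) (B′.base-entry j)))
    perms : ∀ i → σ ⟨$⟩ʳ i ≡ σ′ ⟨$⟩ʳ i
    perms zero = same zero
    perms (suc zero) = same (suc (suc zero))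
    perms (suc (suc zero)) = same (suc zero)

theorem5p9 : (k₁ k₂ k₃ : ℕ) (X Y Z : M2) →
    CMMTriple k₁ k₂ k₃ ⟨ X , Y , Z ⟩ →
    ∣ m12 X ∣L ⊔ ∣ m12 Z ∣L < ∣ m12 Y ∣L →
    Σ L λ f → Σ (Permutation′ 3) λ σ → Σ (List Dir) λ v →
    IsVertex k₁ k₂ k₃ σ f v ⟨ X , Y , Z ⟩ ×
    ((f′ : L) (σ′ : Permutation′ 3) (v′ : List Dir) →
    IsVertex k₁ k₂ k₃ σ′ f′ v′ ⟨ X , Y , Z ⟩ →
    (f′ Defs.≈ f) × (σ′ Data.Fin.Permutation.≈ σ) × (v′ ≡ v))
theorem5p9 k₁ k₂ k₃ X Y Z cmm@(_ , _ , _ , XYZ , _) max =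
  f , σ , reverse p , vertex⇒isVertex {k₁} {k₂} {k₃} {σ} {f} {p} v , unique
  where
  vertex : Existence.SomeVertex k₁ k₂ k₃ ⟨ X , Y , Z ⟩
  vertex = Existence.cmm-vertex k₁ k₂ k₃ X Y Z cmm max
  f : L
  f = proj₁ vertex
  σ : Permutation′ 3
  σ = proj₁ (proj₂ vertex)
  p : List Dir
  p = proj₁ (proj₂ (proj₂ vertex))
  v : Vertex k₁ k₂ k₃ σ f p ⟨ X , Y , Z ⟩
  v = proj₂ (proj₂ (proj₂ vertex))
  unique : ∀ f′ σ′ v′ → IsVertex k₁ k₂ k₃ σ′ f′ v′ ⟨ X , Y , Z ⟩ →
    (f′ Defs.≈ f) × (σ′ Data.Fin.Permutation.≈ σ) × (v′ ≡ reverse p)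
  unique f′ σ′ v′ h =
    let hf , hσ , hp = Uniqueness.vertex-unique k₁ k₂ k₃ {σ′} {σ} {f′} {f} {reverse v′} {p} {⟨ X , Y , Z ⟩}
          (≈M⇒≋M {X · Y · Z} {T k₁ k₂ k₃} XYZ) (isVertex⇒vertex {k₁} {k₂} {k₃} {σ′} {f′} {v′} h) v
    in ≋⇒≈ hf , hσ , trans (sym (reverse-involutive v′)) (cong reverse hp)
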